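{- Let $u_n:=|\mathfrak{A}_{2n+1}(1342,2431)|$ for $n\ge0$ and $U(x):=\sum_{n\ge0}u_nx^n$. Then $$U(x)=\frac{\sqrt{1-4x}}{\sqrt{1-4x}-2x}=\cfrac{1}{1-\cfrac{2x}{1-\cfrac{2x}{1-\cfrac{x}{1-\cfrac{x}{\ddots}}}}},$$ where in the continued fraction all partial numerators after the first two equal $x$.
   Context: $\mathfrak{A}_m(1342,2431)$ is the set of permutations $\pi$ of $[m]$ that are alternating (up-down), i.e. $\pi(1)<\pi(2)>\pi(3)<\pi(4)>\cdots$, and avoid both classical patterns $1342$ and $2431$. -}

module Defs where

open import Data.Fin as Fin using (Fin; toℕ)
import Data.Fin.Properties as Fin
open import Data.Integer using (+_)
open import Data.List as List using (List; length; filter; allFin; cartesianProductWith)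
open import Data.Nat as ℕ using (ℕ; zero; suc; _∸_)
import Data.Nat.Properties as ℕ
open import Data.Product using (∃; _×_; _,_)
open import Data.Rational as ℚ using (ℚ; 0ℚ; 1ℚ; ½)
import Data.Rational.Properties as ℚ
open import Data.Rational.Solver using (module +-*-Solver)
open import Data.Unit using (⊤; tt)
open import Data.Vec using (Vec; []; _∷_; lookup)
open import Data.Vec.Relation.Unary.AllPairs using (AllPairs; allPairs?)
open import Data.Vec.Relation.Unary.Unique.Propositional using (Unique)
open import Relation.Binary.PropositionalEquality using (_≡_; _≢_; refl; sym; trans; cong; cong₂; module ≡-Reasoning)
open import Relation.Nullary using (¬_; Dec; yes; no; contradiction)
open import Relation.Nullary.Decidable using (map′; ¬?; _×-dec_; _→-dec_)
open import Relation.Unary using (Decidable)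

open import Algebra.Bundles using (module CommutativeRing)
open import Algebra.Properties.CommutativeMonoid.Sum
  (CommutativeRing.+-commutativeMonoid ℚ.+-*-commutativeRing)
  using (sum-syntax; sum⁺-syntax; sum-cong-≗; sum-init-last)

-- A word of length k over [m] = Fin m (0-based letters).
Word : ℕ → ℕ → Set
Word m k = Vec (Fin m) k

allWords : ∀ m k → List (Word m k)
allWords m zero    = [] List.∷ List.[]
allWords m (suc k) = cartesianProductWith _∷_ (allFin m) (allWords m k)

-- One-line notation: a word of length m over [m] with distinct letters.
IsPermutation : ∀ {m} → Word m m → Set
IsPermutation π = Unique π

mutual
  -- π(1) < π(2) > π(3) < ⋯
  UpDown : ∀ {m k} → Word m k → Set
  UpDown []           = ⊤
  UpDown (_ ∷ [])     = ⊤
  UpDown (x ∷ y ∷ xs) = x Fin.< y × DownUp (y ∷ xs)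

  DownUp : ∀ {m k} → Word m k → Set
  DownUp []           = ⊤
  DownUp (_ ∷ [])     = ⊤
  DownUp (x ∷ y ∷ xs) = y Fin.< x × UpDown (y ∷ xs)

OrderIsomorphic : ∀ {m l k} → Vec ℕ l → Word m k → Word k l → Set
OrderIsomorphic σ π p = ∀ a b →
  (lookup σ a ℕ.< lookup σ b → lookup π (lookup p a) Fin.< lookup π (lookup p b)) ×
  (lookup π (lookup p a) Fin.< lookup π (lookup p b) → lookup σ a ℕ.< lookup σ b)

-- The vector p lists the positions p₁ < ⋯ < p_l of an occurrence of σ in π.
Contains : ∀ {m l k} → Vec ℕ l → Word m k → Set
Contains {l = l} {k} σ π = ∃ λ (p : Word k l) → AllPairs Fin._<_ p × OrderIsomorphic σ π p

Avoids : ∀ {m l k} → Vec ℕ l → Word m k → Set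
Avoids σ π = ¬ Contains σ π

p1342 p2431 : Vec ℕ 4
p1342 = 1 ∷ 3 ∷ 4 ∷ 2 ∷ []
p2431 = 2 ∷ 4 ∷ 3 ∷ 1 ∷ []

𝔄 : ∀ m → Word m m → Set
𝔄 m π = IsPermutation π × UpDown π × Avoids p1342 π × Avoids p2431 π

anyWord? : ∀ {m} k {P : Word m k → Set} → Decidable P → Dec (∃ P)
anyWord? zero    P? = map′ (λ p → [] , p) (λ { ([] , p) → p }) (P? [])
anyWord? (suc k) P? = map′ (λ { (x , xs , p) → x ∷ xs , p }) (λ { (x ∷ xs , p) → x , xs , p })
                           (Fin.any? λ x → anyWord? k λ xs → P? (x ∷ xs))

mutual
  upDown? : ∀ {m k} → Decidable (UpDown {m} {k})
  upDown? []           = yes tt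
  upDown? (_ ∷ [])     = yes tt
  upDown? (x ∷ y ∷ xs) = (x Fin.<? y) ×-dec downUp? (y ∷ xs)

  downUp? : ∀ {m k} → Decidable (DownUp {m} {k})
  downUp? []           = yes tt
  downUp? (_ ∷ [])     = yes tt
  downUp? (x ∷ y ∷ xs) = (y Fin.<? x) ×-dec upDown? (y ∷ xs)

contains? : ∀ {m l k} (σ : Vec ℕ l) → Decidable (Contains {m} {l} {k} σ)
contains? {l = l} σ π = anyWord? l λ p →
  allPairs? Fin._<?_ p ×-dec
  Fin.all? λ a → Fin.all? λ b →
    let σ< = lookup σ a ℕ.<? lookup σ b
        π< = lookup π (lookup p a) Fin.<? lookup π (lookup p b)
    in (σ< →-dec π<) ×-dec (π< →-dec σ<)

𝔄? : ∀ m → Decidable (𝔄 m)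
𝔄? m π = allPairs? (λ x y → ¬? (x Fin.≟ y)) π ×-dec upDown? π
         ×-dec ¬? (contains? p1342 π) ×-dec ¬? (contains? p2431 π)

∣𝔄∣ : ℕ → ℕ
∣𝔄∣ m = length (filter (𝔄? m) (allWords m m))

u : ℕ → ℕ
u n = ∣𝔄∣ (1 ℕ.+ 2 ℕ.* n)

Series : Set
Series = ℕ → ℚ

infix  4 _≈_ _⟶_
infixl 6 _+_ _-_
infixl 7 _*_ _/_
infix  8 _⁻¹ √_

_≈_ : Series → Series → Set
f ≈ g = ∀ n → f n ≡ g n

fromℕℚ : ℕ → ℚ
fromℕℚ k = (+ k) ℚ./ 1

nat : ℕ → Series
nat k zero    = fromℕℚ k
nat k (suc _) = 0ℚ

X : Series
X 1 = 1ℚ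
X _ = 0ℚ

_+_ _-_ _*_ : Series → Series → Series
(f + g) n = f n ℚ.+ g n
(f - g) n = f n ℚ.- g n
(f * g) n = ∑[ i ≤ n ] (f (toℕ i) ℚ.* g (n ∸ toℕ i))

-- Course-of-values recursion: the n-th coefficient is step n applied to the
-- series whose coefficients below n are the ones already found and whose
-- other coefficients are 0.
truncated : (ℕ → Series → ℚ) → ℕ → Series
truncated step zero    k = 0ℚ
truncated step (suc n) k with k ℕ.≟ n
... | yes _ = step n (truncated step n)
... | no  _ = truncated step n k

recursively : (ℕ → Series → ℚ) → Series
recursively step n = step n (truncated step n)

-- 0 is sent to 0.
recip : ℚ → ℚ
recip q with q ℚ.≟ 0ℚ
... | yes _   = 0ℚ
... | no  q≢0 = (ℚ.1/ q) {{ℚ.≢-nonZero q≢0}}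

-- The multiplicative inverse when f 0 ≢ 0 (see *-inverseʳ), and 0 otherwise.
-- The n-th coefficient is the one making (f * f ⁻¹) n equal to (nat 1) n.
_⁻¹ : Series → Series
f ⁻¹ = recursively λ n g → recip (f 0) ℚ.* (nat 1 - f * g) n

_/_ : Series → Series → Series
f / g = f * g ⁻¹

-- For f 0 ≡ 1ℚ, the square root of f with constant term 1 (see √-square);
-- its n-th coefficient, n ≥ 1, is the one making (√ f * √ f) n equal to f n.
sqrtStep : Series → ℕ → Series → ℚ
sqrtStep f zero    s = 1ℚ
sqrtStep f (suc n) s = ½ ℚ.* (f - s * s) (suc n)

√_ : Series → Series
√ f = recursively (sqrtStep f)

-- Coefficientwise (x-adic) convergence.
_⟶_ : (ℕ → Series) → Series → Set
F ⟶ f = ∀ n → ∃ λ N → ∀ k → N ℕ.≤ k → F k n ≡ f n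

-- The k-th convergent 1/(1 - a₀/(1 - a₁/(⋯/(1 - aₖ₋₁)))).
convergent : (ℕ → Series) → ℕ → Series
convergent a zero    = nat 1
convergent a (suc k) = nat 1 / (nat 1 - a 0 * convergent (λ i → a (suc i)) k)

U : Series
U n = fromℕℚ (u n)

√1-4x : Series
√1-4x = √ (nat 1 - nat 4 * X)

numerators : ℕ → Series
numerators 0             = nat 2 * X
numerators 1             = nat 2 * X
numerators (suc (suc _)) = X

truncated-≥ : ∀ step n k → n ℕ.≤ k → truncated step n k ≡ 0ℚ
truncated-≥ step zero    k _   = refl
truncated-≥ step (suc n) k n<k with k ℕ.≟ n
... | yes refl = contradiction n<k (ℕ.<-irrefl refl)
... | no  _    = truncated-≥ step n k (ℕ.<⇒≤ n<k)

truncated-< : ∀ step n k → k ℕ.< n → truncated step n k ≡ recursively step k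
truncated-< step (suc n) k k<1+n with k ℕ.≟ n
... | yes refl = refl
... | no  k≢n  = truncated-< step n k (ℕ.≤∧≢⇒< (ℕ.s≤s⁻¹ k<1+n) k≢n)

recip-inverse : ∀ q → q ≢ 0ℚ → q ℚ.* recip q ≡ 1ℚ
recip-inverse q q≢0 with q ℚ.≟ 0ℚ
... | yes q≡0 = contradiction q≡0 q≢0
... | no  q≢0 = ℚ.*-inverseʳ q {{ℚ.≢-nonZero q≢0}}


*-inverseʳ : ∀ f → f 0 ≢ 0ℚ → f * f ⁻¹ ≈ nat 1
*-inverseʳ f f₀≢0 n = begin
  f 0 ℚ.* (r ℚ.* (e ℚ.- (f 0 ℚ.* g n ℚ.+ tailSum g))) ℚ.+ tailSum (f ⁻¹)
    ≡⟨ cong₂ (λ a b → f 0 ℚ.* (r ℚ.* (e ℚ.- (f 0 ℚ.* a ℚ.+ b))) ℚ.+ tailSum (f ⁻¹))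
             (truncated-≥ step n n ℕ.≤-refl) tail≡ ⟩
  f 0 ℚ.* (r ℚ.* (e ℚ.- (f 0 ℚ.* 0ℚ ℚ.+ t))) ℚ.+ t
    ≡⟨ solve 4 (λ a r e t → a :* (r :* (e :- (a :* con 0ℚ :+ t))) :+ t
                         := (a :* r) :* (e :- t) :+ t) refl (f 0) r e t ⟩
  (f 0 ℚ.* r) ℚ.* (e ℚ.- t) ℚ.+ t
    ≡⟨ cong (λ q → q ℚ.* (e ℚ.- t) ℚ.+ t) (recip-inverse (f 0) f₀≢0) ⟩
  1ℚ ℚ.* (e ℚ.- t) ℚ.+ t
    ≡⟨ solve 2 (λ e t → con 1ℚ :* (e :- t) :+ t := e) refl e t ⟩
  e ∎
  where
  open ≡-Reasoning
  open +-*-Solver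
  step : ℕ → Series → ℚ
  step n g = recip (f 0) ℚ.* (nat 1 - f * g) n
  r = recip (f 0)
  e = nat 1 n
  g = truncated step n
  tailSum : Series → ℚ
  tailSum h = ∑[ i < n ] (f (suc (toℕ i)) ℚ.* h (n ∸ suc (toℕ i)))
  t = tailSum (f ⁻¹)
  tail≡ : tailSum g ≡ t
  tail≡ = sum-cong-≗ {n} λ i → cong (f (suc (toℕ i)) ℚ.*_)
    (truncated-< step n (n ∸ suc (toℕ i)) (ℕ.∸-monoʳ-< {n} ℕ.z<s (Fin.toℕ<n i)))

√-square : ∀ f → f 0 ≡ 1ℚ → √ f * √ f ≈ f
√-square f f₀≡1 zero    = sym f₀≡1
√-square f f₀≡1 (suc n) = begin
  (s * s) (suc n)
    ≡⟨ split s ⟩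
  1ℚ ℚ.* s (suc n) ℚ.+ (middle s ℚ.+ s (suc n) ℚ.* 1ℚ)
    ≡⟨ cong (λ q → 1ℚ ℚ.* s⁺ q ℚ.+ (middle s ℚ.+ s⁺ q ℚ.* 1ℚ)) (trans (split s′) split′≡) ⟩
  1ℚ ℚ.* s⁺ m ℚ.+ (m ℚ.+ s⁺ m ℚ.* 1ℚ)
    ≡⟨ solve 2 (λ a m → let s⁺ = con ½ :* (a :- m) in
                  con 1ℚ :* s⁺ :+ (m :+ s⁺ :* con 1ℚ) := a) refl (f (suc n)) m ⟩
  f (suc n) ∎
  where
  open ≡-Reasoning
  open +-*-Solver
  s = √ f
  s′ = truncated (sqrtStep f) (suc n)
  s⁺ : ℚ → ℚ
  s⁺ q = ½ ℚ.* (f (suc n) ℚ.- q)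
  middle : Series → ℚ
  middle h = ∑[ i < n ] (h (suc (toℕ i)) ℚ.* h (n ∸ toℕ i))
  m = middle s
  split : ∀ h → (h * h) (suc n) ≡ h 0 ℚ.* h (suc n) ℚ.+ (middle h ℚ.+ h (suc n) ℚ.* h 0)
  split h = cong (h 0 ℚ.* h (suc n) ℚ.+_) (trans
    (sum-init-last {n} (λ i → h (suc (toℕ i)) ℚ.* h (n ∸ toℕ i)))
    (cong₂ ℚ._+_
      (sum-cong-≗ {n} λ i → cong (λ j → h (suc j) ℚ.* h (n ∸ j)) (Fin.toℕ-inject₁ i))
      (trans (cong (λ j → h (suc j) ℚ.* h (n ∸ j)) (Fin.toℕ-fromℕ n))
             (cong (λ j → h (suc n) ℚ.* h j) (ℕ.n∸n≡0 n)))))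
  middle≡ : middle s′ ≡ m
  middle≡ = sum-cong-≗ {n} λ i → cong₂ ℚ._*_
    (truncated-< _ (suc n) (suc (toℕ i)) (ℕ.s<s (Fin.toℕ<n i)))
    (truncated-< _ (suc n) (n ∸ toℕ i) (ℕ.s≤s (ℕ.m∸n≤m n (toℕ i))))
  split′≡ : s′ 0 ℚ.* s′ (suc n) ℚ.+ (middle s′ ℚ.+ s′ (suc n) ℚ.* s′ 0) ≡ m
  split′≡ = begin
    s′ 0 ℚ.* s′ (suc n) ℚ.+ (middle s′ ℚ.+ s′ (suc n) ℚ.* s′ 0)
      ≡⟨ cong₂ (λ z b → s′ 0 ℚ.* z ℚ.+ (b ℚ.+ z ℚ.* s′ 0))
               (truncated-≥ _ (suc n) (suc n) ℕ.≤-refl) middle≡ ⟩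
    s′ 0 ℚ.* 0ℚ ℚ.+ (m ℚ.+ 0ℚ ℚ.* s′ 0)
      ≡⟨ solve 2 (λ c m → c :* con 0ℚ :+ (m :+ con 0ℚ :* c) := m) refl (s′ 0) m ⟩
    m ∎

{-# OPTIONS --safe #-}

-- Build a permutation by placing its values in decreasing order.  A new smallest
-- value may only be placed where no 132 lies to its left and no 231 to its right.
-- For an alternating permutation this forces the peaks waiting for a neighbouring
-- valley to form a stack, increasing away from the place where the next value goes:
-- a peak is pushed, and a valley is written next to the popped peak at the same end
-- of the gap that is still to be filled.  The end can be chosen freely (left or
-- right) exactly when the stack has height 1, for a push as well as for a pop.
-- So u n counts Dyck paths of length 2n in which the up steps 1 → 2 and the down
-- steps 1 → 0 have weight 2, whence the continued fraction.  With C the Catalan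
-- series and δ = √(1 - 4x) = 1 - 2xC, the series of the paths from height h to 0
-- are δ/(δ - 2x) for h = 0 and 2Cʰ⁻¹/(δ - 2x) for h ≥ 1.
module Submission where

open import Defs
open import Algebra.Bundles using (CommutativeSemiring)
open import Algebra.Structures using (IsCommutativeSemiring)
open import Data.Fin as Fin using (Fin; zero; suc; toℕ; fromℕ<)
open import Data.Fin.Patterns using (0F; 1F; 2F; 3F)
import Data.Fin.Properties as Fin
import Data.Integer as ℤ
import Data.Integer.Properties as ℤ
open import Data.List as List using (List; []; _∷_; _++_; filter; length; map; reverse; [_])
open import Data.List.Membership.DecPropositional using (_∈?_)
open import Data.List.Membership.Propositional using (_∈_; _∉_)
open import Data.List.Membership.Propositional.Properties
  using ( ∈-++⁺ˡ; ∈-++⁺ʳ; ∈-++⁻; ∈-map⁺; ∈-map⁻; ∈-filter⁺; ∈-filter⁻; ∈-∃++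
        ; ∈-upTo⁺; ∈-upTo⁻; ∈-allFin; ∈-cartesianProductWith⁺ )
import Data.List.Properties as List
open import Data.List.Relation.Binary.Disjoint.Propositional using (Disjoint)
open import Data.List.Relation.Binary.Permutation.Propositional using (↭-sym; ↭⇒↭ₛ)
open import Data.List.Relation.Binary.Permutation.Propositional.Properties using (↭-reverse)
import Data.List.Relation.Binary.Permutation.Setoid.Properties as Permutationₛ
open import Data.List.Relation.Binary.Sublist.Propositional
  using (_⊆_; []; _∷_; _∷ʳ_; ⊆-refl; ⊆-trans; lookup)
import Data.List.Relation.Binary.Sublist.Propositional.Properties as Sublist
open import Data.List.Relation.Unary.All as All using (All; []; _∷_)
open import Data.List.Relation.Unary.AllPairs using (AllPairs; []; _∷_)
open import Data.List.Relation.Unary.Any using (here; there)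
import Data.List.Relation.Unary.Any.Properties as Any
open import Data.List.Relation.Unary.Unique.Propositional using (Unique)
import Data.List.Relation.Unary.Unique.Propositional.Properties as Unique
open import Data.Nat as ℕ using (ℕ; zero; suc; z≤n; s≤s)
import Data.Nat.Properties as ℕ
open import Data.Product using (_×_; _,_; ∃; ∃₂; proj₁; proj₂)
open import Data.Rational as ℚ using (ℚ; 0ℚ; 1ℚ; ½)
import Data.Rational.Properties as ℚ
import Data.Rational.Solver as ℚSolver
import Data.Rational.Unnormalised as ℚᵘ
import Data.Rational.Unnormalised.Properties as ℚᵘ
open import Data.Sum using (_⊎_; inj₁; inj₂; [_,_]′)
open import Data.Unit using (tt)
open import Data.Vec as Vec using (Vec; []; _∷_)
import Data.Vec.Properties as Vec
open import Data.Vec.Relation.Unary.All as Vecᵃ using ([]; _∷_)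
import Data.Vec.Relation.Unary.All.Properties as Vecᵃ
open import Data.Vec.Relation.Unary.AllPairs as Vecᵖ using ([]; _∷_)
import Data.Vec.Relation.Unary.AllPairs.Properties as Vecᵖ
import Data.Vec.Relation.Unary.Unique.Propositional as Vecᵘ
open import Function using (_∘_; id)
open import Level using (0ℓ)
open import Relation.Binary.Definitions using (tri<; tri≈; tri>)
open import Relation.Binary.PropositionalEquality
  using (_≡_; _≢_; refl; sym; trans; cong; cong₂; subst; subst₂; setoid; module ≡-Reasoning)
open import Relation.Binary.Structures using (IsEquivalence)
open import Relation.Nullary using (¬_; yes; no; contradiction)
open import Relation.Unary using (Pred; Decidable)

open ℚSolver.+-*-Solver using ()
  renaming (solve to solveℚ; _:+_ to _⊕_; _:*_ to _⊗_; _:-_ to _⊖_; :-_ to ⊖_; _:=_ to _⊜_; con to κ)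

-- Formal power series

-- The sum defining a product unfolds by definition: `(f * g) (suc n)` is
-- `f 0 ℚ.* g (suc n) ℚ.+ (tail f * g) n`. The product laws below are inductions along this
-- recursion.
tail : Series → Series
tail f n = f (suc n)

infixr 7 _·_
_·_ : ℚ → Series → Series
(c · f) n = c ℚ.* f n

≈-isEquivalence : IsEquivalence _≈_
≈-isEquivalence = record
  { refl = λ _ → refl ; sym = λ p n → sym (p n) ; trans = λ p q n → trans (p n) (q n) }

*-cong-≤ : ∀ n {f f′ g g′} → (∀ i → i ℕ.≤ n → f i ≡ f′ i) → (∀ i → i ℕ.≤ n → g i ≡ g′ i) →
           (f * g) n ≡ (f′ * g′) n
*-cong-≤ zero p q = cong₂ (λ a b → a ℚ.* b ℚ.+ 0ℚ) (p 0 z≤n) (q 0 z≤n)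
*-cong-≤ (suc n) p q = cong₂ ℚ._+_
  (cong₂ ℚ._*_ (p 0 z≤n) (q (suc n) ℕ.≤-refl))
  (*-cong-≤ n (λ i i≤n → p (suc i) (s≤s i≤n)) (λ i i≤n → q i (ℕ.m≤n⇒m≤1+n i≤n)))

*-cong : ∀ {f f′ g g′} → f ≈ f′ → g ≈ g′ → f * g ≈ f′ * g′
*-cong p q n = *-cong-≤ n (λ i _ → p i) (λ i _ → q i)

*-distribʳ-+ : ∀ h f g → (f + g) * h ≈ f * h + g * h
*-distribʳ-+ h f g zero = solveℚ 3 (λ a b c →
  (b ⊕ c) ⊗ a ⊕ κ 0ℚ ⊜ (b ⊗ a ⊕ κ 0ℚ) ⊕ (c ⊗ a ⊕ κ 0ℚ)) refl (h 0) (f 0) (g 0)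
*-distribʳ-+ h f g (suc n) = trans
  (cong ((f 0 ℚ.+ g 0) ℚ.* h (suc n) ℚ.+_) (*-distribʳ-+ h (tail f) (tail g) n))
  (solveℚ 5 (λ a b c d e → (b ⊕ c) ⊗ a ⊕ (d ⊕ e) ⊜ (b ⊗ a ⊕ d) ⊕ (c ⊗ a ⊕ e)) refl
    (h (suc n)) (f 0) (g 0) ((tail f * h) n) ((tail g * h) n))

·-*-assoc : ∀ c f g → (c · f) * g ≈ c · (f * g)
·-*-assoc c f g zero = solveℚ 3 (λ c a b →
  (c ⊗ a) ⊗ b ⊕ κ 0ℚ ⊜ c ⊗ (a ⊗ b ⊕ κ 0ℚ)) refl c (f 0) (g 0)
·-*-assoc c f g (suc n) = trans
  (cong ((c ℚ.* f 0) ℚ.* g (suc n) ℚ.+_) (·-*-assoc c (tail f) g n))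
  (solveℚ 4 (λ c a b d → (c ⊗ a) ⊗ b ⊕ c ⊗ d ⊜ c ⊗ (a ⊗ b ⊕ d)) refl
    c (f 0) (g (suc n)) ((tail f * g) n))

*-assoc : ∀ f g h → (f * g) * h ≈ f * (g * h)
*-assoc f g h zero = solveℚ 3 (λ a b c →
  (a ⊗ b ⊕ κ 0ℚ) ⊗ c ⊕ κ 0ℚ ⊜ a ⊗ (b ⊗ c ⊕ κ 0ℚ) ⊕ κ 0ℚ) refl (f 0) (g 0) (h 0)
*-assoc f g h (suc n) = begin
  -- By definition `tail (f * g)` is coefficientwise `f 0 · tail g + tail f * g`.
  (f 0 ℚ.* g 0 ℚ.+ 0ℚ) ℚ.* h (suc n) ℚ.+ ((f 0 · tail g + tail f * g) * h) n
    ≡⟨ cong ((f 0 ℚ.* g 0 ℚ.+ 0ℚ) ℚ.* h (suc n) ℚ.+_) (trans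
         (*-distribʳ-+ h (f 0 · tail g) (tail f * g) n)
         (cong₂ ℚ._+_ (·-*-assoc (f 0) (tail g) h n) (*-assoc (tail f) g h n))) ⟩
  (f 0 ℚ.* g 0 ℚ.+ 0ℚ) ℚ.* h (suc n) ℚ.+ (f 0 ℚ.* (tail g * h) n ℚ.+ (tail f * (g * h)) n)
    ≡⟨ solveℚ 5 (λ a b c d e → (a ⊗ b ⊕ κ 0ℚ) ⊗ c ⊕ (a ⊗ d ⊕ e)
                             ⊜ a ⊗ (b ⊗ c ⊕ d) ⊕ e) refl
         (f 0) (g 0) (h (suc n)) ((tail g * h) n) ((tail f * (g * h)) n) ⟩
  f 0 ℚ.* (g * h) (suc n) ℚ.+ (tail f * (g * h)) n ∎
  where open ≡-Reasoning

-- The mirror image of the definitional recursion, splitting off the last summand instead of the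
-- first; commutativity compares the two.
*-unfoldʳ : ∀ f g n → (f * g) (suc n) ≡ (f * tail g) n ℚ.+ f (suc n) ℚ.* g 0
*-unfoldʳ f g zero = solveℚ 4 (λ a b c d →
  a ⊗ b ⊕ (c ⊗ d ⊕ κ 0ℚ) ⊜ (a ⊗ b ⊕ κ 0ℚ) ⊕ c ⊗ d) refl (f 0) (g 1) (f 1) (g 0)
*-unfoldʳ f g (suc n) = trans
  (cong (f 0 ℚ.* g (suc (suc n)) ℚ.+_) (*-unfoldʳ (tail f) g n))
  (sym (ℚ.+-assoc (f 0 ℚ.* g (suc (suc n))) ((tail f * tail g) n) (f (suc (suc n)) ℚ.* g 0)))

*-comm : ∀ f g → f * g ≈ g * f
*-comm f g zero = cong (ℚ._+ 0ℚ) (ℚ.*-comm (f 0) (g 0))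
*-comm f g (suc n) = begin
  f 0 ℚ.* g (suc n) ℚ.+ (tail f * g) n
    ≡⟨ cong (f 0 ℚ.* g (suc n) ℚ.+_) (*-comm (tail f) g n) ⟩
  f 0 ℚ.* g (suc n) ℚ.+ (g * tail f) n
    ≡⟨ solveℚ 3 (λ a b c → a ⊗ b ⊕ c ⊜ c ⊕ b ⊗ a) refl (f 0) (g (suc n)) ((g * tail f) n) ⟩
  (g * tail f) n ℚ.+ g (suc n) ℚ.* f 0
    ≡⟨ *-unfoldʳ g f n ⟨
  (g * f) (suc n) ∎
  where open ≡-Reasoning

0-*ˡ : ∀ z f → (∀ i → z i ≡ 0ℚ) → ∀ n → (z * f) n ≡ 0ℚ
0-*ˡ z f z≡0 zero = trans (cong (λ a → a ℚ.* f 0 ℚ.+ 0ℚ) (z≡0 0))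
  (solveℚ 1 (λ a → κ 0ℚ ⊗ a ⊕ κ 0ℚ ⊜ κ 0ℚ) refl (f 0))
0-*ˡ z f z≡0 (suc n) = trans
  (cong₂ (λ a b → a ℚ.* f (suc n) ℚ.+ b) (z≡0 0) (0-*ˡ (tail z) f (z≡0 ∘ suc) n))
  (solveℚ 1 (λ a → κ 0ℚ ⊗ a ⊕ κ 0ℚ ⊜ κ 0ℚ) refl (f (suc n)))

nat-* : ∀ k f n → (nat k * f) n ≡ fromℕℚ k ℚ.* f n
nat-* k f zero = ℚ.+-identityʳ (fromℕℚ k ℚ.* f 0)
nat-* k f (suc n) = trans
  (cong (fromℕℚ k ℚ.* f (suc n) ℚ.+_) (0-*ˡ (tail (nat k)) f (λ _ → refl) n))
  (ℚ.+-identityʳ (fromℕℚ k ℚ.* f (suc n)))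

nat-0≡0 : ∀ n → nat 0 n ≡ 0ℚ
nat-0≡0 zero    = refl
nat-0≡0 (suc _) = refl

X-*-zero : ∀ f → (X * f) 0 ≡ 0ℚ
X-*-zero f = solveℚ 1 (λ a → κ 0ℚ ⊗ a ⊕ κ 0ℚ ⊜ κ 0ℚ) refl (f 0)

tail-X : tail X ≈ nat 1
tail-X zero    = refl
tail-X (suc _) = refl

*-identityˡ : ∀ f → nat 1 * f ≈ f
*-identityˡ f n = trans (nat-* 1 f n) (ℚ.*-identityˡ (f n))

X-*-suc : ∀ f n → (X * f) (suc n) ≡ f n
X-*-suc f n = trans
  (cong₂ ℚ._+_ (ℚ.*-zeroˡ (f (suc n))) (trans (*-cong {g = f} tail-X (λ _ → refl) n) (*-identityˡ f n)))
  (ℚ.+-identityˡ (f n))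

-- This feeds the solver `Semi`. Its polynomials have no subtraction, so identities are arranged as
-- equations between sums, and differences are handled by `-‿+-cancel` and `+⇒-`.
series-isCommutativeSemiring : IsCommutativeSemiring _≈_ _+_ _*_ (nat 0) (nat 1)
series-isCommutativeSemiring = record
  { isSemiring = record
    { isSemiringWithoutAnnihilatingZero = record
      { +-isCommutativeMonoid = record
        { isMonoid = record
          { isSemigroup = record
            { isMagma = record
              { isEquivalence = ≈-isEquivalence
              ; ∙-cong = λ p q n → cong₂ ℚ._+_ (p n) (q n) }
            ; assoc = λ f g h n → ℚ.+-assoc (f n) (g n) (h n) }
          ; identity = +-identityˡ , λ f n → trans (ℚ.+-comm (f n) (nat 0 n)) (+-identityˡ f n) }
        ; comm = λ f g n → ℚ.+-comm (f n) (g n) }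
      ; *-cong = *-cong
      ; *-assoc = *-assoc
      ; *-identity = *-identityˡ , λ f n → trans (*-comm f (nat 1) n) (*-identityˡ f n)
      ; distrib = (λ f g h n → trans (*-comm f (g + h) n) (trans (*-distribʳ-+ f g h n)
                     (cong₂ ℚ._+_ (*-comm g f n) (*-comm h f n)))) , *-distribʳ-+ }
    ; zero = zeroˡ , λ f n → trans (*-comm f (nat 0) n) (zeroˡ f n) }
  ; *-comm = *-comm }
  where
  +-identityˡ : ∀ f → nat 0 + f ≈ f
  +-identityˡ f n = trans (cong (ℚ._+ f n) (nat-0≡0 n)) (ℚ.+-identityˡ (f n))
  zeroˡ : ∀ f → nat 0 * f ≈ nat 0
  zeroˡ f n = trans (0-*ˡ (nat 0) f nat-0≡0 n) (sym (nat-0≡0 n))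

seriesSemiring : CommutativeSemiring 0ℓ 0ℓ
seriesSemiring = record { isCommutativeSemiring = series-isCommutativeSemiring }

module 𝕊 = CommutativeSemiring seriesSemiring
import Algebra.Solver.Ring.NaturalCoefficients.Default seriesSemiring as Semi
import Relation.Binary.Reasoning.Setoid 𝕊.setoid as ≈-Reasoning
open Semi using (_:+_; _:*_; _:=_)

-- Catalan series

δ : Series
δ = √1-4x

-- This is `(1 - δ) / 2x`: division by `x` drops the vanishing constant term of `1 - δ` and shifts
-- the rest.
catalan : Series
catalan n = ℚ.- (½ ℚ.* δ (suc n))

quadruple : Series → Series
quadruple f = (f + f) + (f + f)

nat-2-* : ∀ f → nat 2 * f ≈ f + f
nat-2-* f n = trans (nat-* 2 f n) (solveℚ 1 (λ a → κ (fromℕℚ 2) ⊗ a ⊜ a ⊕ a) refl (f n))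

nat-4-* : ∀ f → nat 4 * f ≈ quadruple f
nat-4-* f n = trans (nat-* 4 f n)
  (solveℚ 1 (λ a → κ (fromℕℚ 4) ⊗ a ⊜ (a ⊕ a) ⊕ (a ⊕ a)) refl (f n))

-‿+-cancel : ∀ f g → (f - g) + g ≈ f
-‿+-cancel f g n = solveℚ 2 (λ a b → (a ⊖ b) ⊕ b ⊜ a) refl (f n) (g n)

+-cancelˡ : ∀ h {f g} → h + f ≈ h + g → f ≈ g
+-cancelˡ h eq n = ℚ+.∙-cancelˡ (h n) _ _ (eq n)
  where import Algebra.Properties.Group ℚ.+-0-group as ℚ+

quadruple-X-cancel : ∀ f g → quadruple (X * f) ≈ quadruple (X * g) → f ≈ g
quadruple-X-cancel f g eq n = trans (sym (quarter f)) (trans (cong ((½ ℚ.* ½) ℚ.*_) (eq (suc n))) (quarter g))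
  where
  quarter : ∀ f → (½ ℚ.* ½) ℚ.* quadruple (X * f) (suc n) ≡ f n
  quarter f = trans (cong (λ a → (½ ℚ.* ½) ℚ.* ((a ℚ.+ a) ℚ.+ (a ℚ.+ a))) (X-*-suc f n))
    (solveℚ 1 (λ a → κ (½ ℚ.* ½) ⊗ ((a ⊕ a) ⊕ (a ⊕ a)) ⊜ a) refl (f n))

δ²+4X≈1 : δ * δ + quadruple X ≈ nat 1
δ²+4X≈1 = begin
  δ * δ + quadruple X                     ≈⟨ 𝕊.+-congˡ {δ * δ} (nat-4-* X) ⟨
  δ * δ + nat 4 * X                       ≈⟨ 𝕊.+-congʳ (√-square (nat 1 - nat 4 * X) refl) ⟩
  (nat 1 - nat 4 * X) + nat 4 * X         ≈⟨ -‿+-cancel (nat 1) (nat 4 * X) ⟩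
  nat 1                                   ∎
  where open ≈-Reasoning

δ+2XC≈1 : δ + (X * catalan + X * catalan) ≈ nat 1
δ+2XC≈1 zero = cong (λ a → δ 0 ℚ.+ (a ℚ.+ a)) (X-*-zero catalan)
δ+2XC≈1 (suc n) = trans
  (cong (λ a → δ (suc n) ℚ.+ (a ℚ.+ a)) (X-*-suc catalan n))
  (solveℚ 1 (λ a → a ⊕ (⊖ (κ ½ ⊗ a) ⊕ ⊖ (κ ½ ⊗ a)) ⊜ κ 0ℚ) refl (δ (suc n)))

-- Put `Y = XC`. Squaring `δ + 2Y = 1` and comparing with `δ² + 4X = 1` gives `4Yδ + 4Y² = 4X`.
-- Hence `4Y = 4Y(δ + 2Y) = 4X + 4Y² = 4X(1 + XC²)`, and `4X` cancels.
catalan-eq : catalan ≈ nat 1 + X * (catalan * catalan)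
catalan-eq = quadruple-X-cancel C (nat 1 + X * (C * C)) (begin
  quadruple Y                          ≈⟨ 𝕊.*-identityʳ (quadruple Y) ⟨
  quadruple Y * nat 1                  ≈⟨ 𝕊.*-congˡ {quadruple Y} δ+2XC≈1 ⟨
  quadruple Y * (δ + (Y + Y))
    ≈⟨ Semi.solve 2 (λ δ Y → quad Y :* (δ :+ (Y :+ Y)) := (quad (Y :* δ) :+ quad (Y :* Y)) :+ quad (Y :* Y))
         𝕊.refl δ Y ⟩
  (quadruple (Y * δ) + quadruple (Y * Y)) + quadruple (Y * Y)
    ≈⟨ 𝕊.+-congʳ (+-cancelˡ (δ * δ) square) ⟩
  quadruple X + quadruple (Y * Y)
    ≈⟨ 𝕊.+-congʳ (quadruple-cong (𝕊.*-identityʳ X)) ⟨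
  quadruple (X * nat 1) + quadruple (Y * Y)
    ≈⟨ Semi.solve 3 (λ X C o → quad (X :* o) :+ quad ((X :* C) :* (X :* C)) := quad (X :* (o :+ X :* (C :* C))))
         𝕊.refl X C (nat 1) ⟩
  quadruple (X * (nat 1 + X * (C * C))) ∎)
  where
  open ≈-Reasoning
  C = catalan
  Y = X * C
  quad : ∀ {n} → Semi.Polynomial n → Semi.Polynomial n
  quad p = (p :+ p) :+ (p :+ p)
  quadruple-cong : ∀ {f g} → f ≈ g → quadruple f ≈ quadruple g
  quadruple-cong eq n = cong (λ a → (a ℚ.+ a) ℚ.+ (a ℚ.+ a)) (eq n)
  square : δ * δ + (quadruple (Y * δ) + quadruple (Y * Y)) ≈ δ * δ + quadruple X
  square = begin
    δ * δ + (quadruple (Y * δ) + quadruple (Y * Y))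
      ≈⟨ Semi.solve 2 (λ δ Y → δ :* δ :+ (quad (Y :* δ) :+ quad (Y :* Y))
           := (δ :+ (Y :+ Y)) :* (δ :+ (Y :+ Y))) 𝕊.refl δ Y ⟩
    (δ + (Y + Y)) * (δ + (Y + Y))   ≈⟨ *-cong δ+2XC≈1 δ+2XC≈1 ⟩
    nat 1 * nat 1                   ≈⟨ *-identityˡ (nat 1) ⟩
    nat 1                           ≈⟨ δ²+4X≈1 ⟨
    δ * δ + quadruple X             ∎

-- Generating series of the weighted paths

D : Series
D = (δ - nat 2 * X) ⁻¹

δD≈1+2XD : δ * D ≈ nat 1 + X * (D + D)
δD≈1+2XD = begin
  δ * D                                         ≈⟨ 𝕊.*-congʳ {D} (-‿+-cancel δ (nat 2 * X)) ⟨
  ((δ - nat 2 * X) + nat 2 * X) * D             ≈⟨ *-distribʳ-+ D (δ - nat 2 * X) (nat 2 * X) ⟩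
  (δ - nat 2 * X) * D + nat 2 * X * D
    ≈⟨ 𝕊.+-cong (*-inverseʳ (δ - nat 2 * X) λ ()) (𝕊.*-congʳ {D} (nat-2-* X)) ⟩
  nat 1 + (X + X) * D
    ≈⟨ Semi.solve 3 (λ X D o → o :+ (X :+ X) :* D := o :+ X :* (D :+ D)) 𝕊.refl X D (nat 1) ⟩
  nat 1 + X * (D + D) ∎
  where open ≈-Reasoning

pathSeries : ℕ → Series
pathSeries 0             = δ * D
pathSeries 1             = D + D
pathSeries (suc (suc h)) = catalan * pathSeries (suc h)

-- This and the next two equations are the first-step decompositions of the paths, with `X` marking
-- the up steps; the summand `nat 1` is the empty path.
pathSeries-0 : pathSeries 0 ≈ nat 1 + X * pathSeries 1
pathSeries-0 = δD≈1+2XD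

-- Multiplying `D + D` by `δ + 2XC = 1` separates the paths that first go up (the part `2XC`) from
-- those that first go down (the part `δ`).
pathSeries-1 : pathSeries 1 ≈ (X * pathSeries 2 + pathSeries 0) + (X * pathSeries 2 + pathSeries 0)
pathSeries-1 = begin
  D + D                                             ≈⟨ 𝕊.*-identityʳ (D + D) ⟨
  (D + D) * nat 1                                   ≈⟨ 𝕊.*-congˡ {D + D} δ+2XC≈1 ⟨
  (D + D) * (δ + (X * catalan + X * catalan))
    ≈⟨ Semi.solve 4 (λ D δ X C → (D :+ D) :* (δ :+ (X :* C :+ X :* C))
         := (X :* (C :* (D :+ D)) :+ δ :* D) :+ (X :* (C :* (D :+ D)) :+ δ :* D)) 𝕊.refl D δ X catalan ⟩
  (X * (catalan * (D + D)) + δ * D) + (X * (catalan * (D + D)) + δ * D) ∎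
  where open ≈-Reasoning

pathSeries-2+ : ∀ h → pathSeries (2 ℕ.+ h) ≈ X * pathSeries (3 ℕ.+ h) + pathSeries (1 ℕ.+ h)
pathSeries-2+ h = begin
  C * P                       ≈⟨ 𝕊.*-congʳ {P} catalan-eq ⟩
  (nat 1 + X * (C * C)) * P
    ≈⟨ Semi.solve 4 (λ o X C P → (o :+ X :* (C :* C)) :* P := X :* (C :* (C :* P)) :+ o :* P)
         𝕊.refl (nat 1) X C P ⟩
  X * (C * (C * P)) + nat 1 * P ≈⟨ 𝕊.+-congˡ {X * (C * (C * P))} (*-identityˡ P) ⟩
  X * (C * (C * P)) + P       ∎
  where
  open ≈-Reasoning
  C = catalan
  P = pathSeries (suc h)

-- Counting paths

-- pathCount k h: k values remain to be placed and h peaks are on the stack.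
pathCount : ℕ → ℕ → ℕ
pathCount zero          _             = 0
pathCount (suc k)       1             = (pathCount k 2 ℕ.+ pathCount k 0) ℕ.+ (pathCount k 2 ℕ.+ pathCount k 0)
pathCount (suc k)       (suc (suc h)) = pathCount k (3 ℕ.+ h) ℕ.+ pathCount k (suc h)
pathCount (suc zero)    0             = 1
pathCount (suc (suc k)) 0             = pathCount (suc k) 1

-- Each waiting peak costs one pop, and the gap left at the end takes one value more.
pathCount-≤ : ∀ {k h} → k ℕ.≤ h → pathCount k h ≡ 0
pathCount-≤ {zero}        {h}           _ = refl
pathCount-≤ {suc zero}    {suc zero}    _ = refl
pathCount-≤ {suc zero}    {suc (suc h)} _ = refl
pathCount-≤ {suc (suc k)} {suc zero}    (s≤s ())
pathCount-≤ {suc (suc k)} {suc (suc h)} (s≤s k≤h) =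
  cong₂ ℕ._+_ (pathCount-≤ {suc k} (ℕ.m≤n⇒m≤1+n (ℕ.m≤n⇒m≤1+n k≤h))) (pathCount-≤ {suc k} k≤h)

-- Unlike `2 ℕ.* n`, this exposes two successors per step, so that `pathCount` and matching on the
-- length of a word compute.
double : ℕ → ℕ
double zero    = zero
double (suc n) = suc (suc (double n))

double≡2* : ∀ n → double n ≡ 2 ℕ.* n
double≡2* zero    = refl
double≡2* (suc n) = cong suc (trans (cong suc (double≡2* n)) (sym (ℕ.+-suc n (n ℕ.+ 0))))

fromℕℚ-+ : ∀ a b → fromℕℚ (a ℕ.+ b) ≡ fromℕℚ a ℚ.+ fromℕℚ b
fromℕℚ-+ a b = ℚ.toℚᵘ-injective (begin
  ℚ.toℚᵘ (fromℕℚ (a ℕ.+ b))                        ≈⟨ ℚ.toℚᵘ-fromℚᵘ _ ⟩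
  ℚᵘ.mkℚᵘ (ℤ.+ (a ℕ.+ b)) 0
    ≈⟨ ℚᵘ.*≡* (trans (ℤ.*-identityʳ _) (sym (trans (ℤ.*-identityʳ _)
         (cong₂ ℤ._+_ (ℤ.*-identityʳ (ℤ.+ a)) (ℤ.*-identityʳ (ℤ.+ b)))))) ⟩
  ℚᵘ.mkℚᵘ (ℤ.+ a) 0 ℚᵘ.+ ℚᵘ.mkℚᵘ (ℤ.+ b) 0
    ≈⟨ ℚᵘ.+-cong (ℚ.toℚᵘ-fromℚᵘ (ℚᵘ.mkℚᵘ (ℤ.+ a) 0)) (ℚ.toℚᵘ-fromℚᵘ (ℚᵘ.mkℚᵘ (ℤ.+ b) 0)) ⟨
  ℚ.toℚᵘ (fromℕℚ a) ℚᵘ.+ ℚ.toℚᵘ (fromℕℚ b)        ≈⟨ ℚ.toℚᵘ-homo-+ (fromℕℚ a) (fromℕℚ b) ⟨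
  ℚ.toℚᵘ (fromℕℚ a ℚ.+ fromℕℚ b)                  ∎)
  where open ℚᵘ.≃-Reasoning

-- A path from height `h` with `n` up steps has `h + 2n` steps; the further value closes the last
-- gap.
pathCount-series : ∀ n h → fromℕℚ (pathCount (suc (h ℕ.+ double n)) h) ≡ pathSeries h n
-- The situation after an up step: one up step fewer remains, which is the shift by `X`. For `n = 0`
-- too few values remain to empty the stack.
X-pathCount-series : ∀ n h → fromℕℚ (pathCount (suc (h ℕ.+ double n)) (2 ℕ.+ h)) ≡ (X * pathSeries (2 ℕ.+ h)) n

pathCount-series zero 0 = sym (trans (pathSeries-0 0) (cong (1ℚ ℚ.+_) (X-*-zero (pathSeries 1))))
pathCount-series (suc n) 0 = begin
  fromℕℚ (pathCount (suc (suc (double n))) 1)   ≡⟨ pathCount-series n 1 ⟩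
  pathSeries 1 n                                ≡⟨ X-*-suc (pathSeries 1) n ⟨
  (X * pathSeries 1) (suc n)                    ≡⟨ ℚ.+-identityˡ ((X * pathSeries 1) (suc n)) ⟨
  (nat 1 + X * pathSeries 1) (suc n)            ≡⟨ pathSeries-0 (suc n) ⟨
  pathSeries 0 (suc n)                          ∎
  where open ≡-Reasoning
pathCount-series n 1 = begin
  fromℕℚ (l ℕ.+ l)           ≡⟨ fromℕℚ-+ l l ⟩
  fromℕℚ l ℚ.+ fromℕℚ l      ≡⟨ cong (λ q → q ℚ.+ q) (trans
      (fromℕℚ-+ (pathCount (suc (double n)) 2) (pathCount (suc (double n)) 0))
      (cong₂ ℚ._+_ (X-pathCount-series n 0) (pathCount-series n 0))) ⟩
  ((X * pathSeries 2 + pathSeries 0) + (X * pathSeries 2 + pathSeries 0)) n ≡⟨ pathSeries-1 n ⟨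
  pathSeries 1 n ∎
  where
  open ≡-Reasoning
  l = pathCount (suc (double n)) 2 ℕ.+ pathCount (suc (double n)) 0
pathCount-series n (suc (suc h)) = begin
  fromℕℚ (pathCount k (3 ℕ.+ h) ℕ.+ pathCount k (suc h))
    ≡⟨ fromℕℚ-+ (pathCount k (3 ℕ.+ h)) (pathCount k (suc h)) ⟩
  fromℕℚ (pathCount k (3 ℕ.+ h)) ℚ.+ fromℕℚ (pathCount k (suc h))
    ≡⟨ cong₂ ℚ._+_ (X-pathCount-series n (suc h)) (pathCount-series n (suc h)) ⟩
  (X * pathSeries (3 ℕ.+ h) + pathSeries (suc h)) n ≡⟨ pathSeries-2+ h n ⟨
  pathSeries (2 ℕ.+ h) n ∎
  where
  open ≡-Reasoning
  k = 2 ℕ.+ (h ℕ.+ double n)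

X-pathCount-series zero h = trans
  (cong fromℕℚ (pathCount-≤ {suc (h ℕ.+ 0)} {2 ℕ.+ h}
    (s≤s (ℕ.≤-trans (ℕ.≤-reflexive (ℕ.+-identityʳ h)) (ℕ.n≤1+n h)))))
  (sym (X-*-zero (pathSeries (2 ℕ.+ h))))
X-pathCount-series (suc n) h = begin
  fromℕℚ (pathCount (suc (h ℕ.+ (2 ℕ.+ double n))) (2 ℕ.+ h))
    ≡⟨ cong (λ k → fromℕℚ (pathCount (suc k) (2 ℕ.+ h)))
         (trans (ℕ.+-suc h (suc (double n))) (cong suc (ℕ.+-suc h (double n)))) ⟩
  fromℕℚ (pathCount (3 ℕ.+ (h ℕ.+ double n)) (2 ℕ.+ h))   ≡⟨ pathCount-series n (2 ℕ.+ h) ⟩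
  pathSeries (2 ℕ.+ h) n                                  ≡⟨ X-*-suc (pathSeries (2 ℕ.+ h)) n ⟨
  (X * pathSeries (2 ℕ.+ h)) (suc n)                      ∎
  where open ≡-Reasoning

-- Continued fractions

-- Since the constant term of `a` vanishes, the top coefficient of the other factor does not enter.
-- So each level of the continued fraction gains one correct coefficient.
*-cong-<ʳ : ∀ a {f g} → a 0 ≡ 0ℚ → ∀ n → (∀ i → i ℕ.< n → f i ≡ g i) → (a * f) n ≡ (a * g) n
*-cong-<ʳ a {f} {g} a₀≡0 zero    p = trans (at0 f) (sym (at0 g))
  where
  at0 : ∀ f → (a * f) 0 ≡ 0ℚ
  at0 f = trans (cong (λ c → c ℚ.* f 0 ℚ.+ 0ℚ) a₀≡0) (cong (ℚ._+ 0ℚ) (ℚ.*-zeroˡ (f 0)))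
*-cong-<ʳ a {f} {g} a₀≡0 (suc n) p = cong₂ ℚ._+_
  (trans (at0 f) (sym (at0 g)))
  (*-cong-≤ n {tail a} {tail a} (λ _ _ → refl) (λ i i≤n → p i (s≤s i≤n)))
  where
  at0 : ∀ f → a 0 ℚ.* f (suc n) ≡ 0ℚ
  at0 f = trans (cong (ℚ._* f (suc n)) a₀≡0) (ℚ.*-zeroˡ (f (suc n)))

-- Multiply `p ⁻¹` by `q * t`, replace `q` by `p`, which changes no coefficient up to `n`, and
-- cancel `p` against its inverse.
⁻¹-unique-≤ : ∀ {p q t} n → p 0 ≢ 0ℚ → (∀ i → i ℕ.≤ n → p i ≡ q i) → q * t ≈ nat 1 → (p ⁻¹) n ≡ t n
⁻¹-unique-≤ {p} {q} {t} n p₀≢0 p≡q qt≈1 = begin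
  (p ⁻¹) n               ≡⟨ 𝕊.*-identityʳ (p ⁻¹) n ⟨
  (p ⁻¹ * nat 1) n       ≡⟨ 𝕊.*-congˡ {p ⁻¹} qt≈1 n ⟨
  (p ⁻¹ * (q * t)) n     ≡⟨ *-cong-≤ n {p ⁻¹} {p ⁻¹} (λ _ _ → refl) (λ i i≤n →
                              *-cong-≤ i {p} {q} {t} {t} (λ j j≤i → p≡q j (ℕ.≤-trans j≤i i≤n)) (λ _ _ → refl)) ⟨
  (p ⁻¹ * (p * t)) n     ≡⟨ Semi.solve 3 (λ p p′ t → p′ :* (p :* t) := (p :* p′) :* t) 𝕊.refl p (p ⁻¹) t n ⟩
  (p * p ⁻¹ * t) n       ≡⟨ 𝕊.*-congʳ {t} (*-inverseʳ p p₀≢0) n ⟩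
  (nat 1 * t) n          ≡⟨ *-identityˡ t n ⟩
  t n ∎
  where open ≡-Reasoning

-- Induction on `k` with both sequences shifted: the inner convergent is correct below degree `k`,
-- the factor `a 0` raises this bound by one, and inversion preserves it.
convergent-tails : ∀ (a T : ℕ → Series) → (∀ i → a i 0 ≡ 0ℚ) →
                   (∀ i → (nat 1 - a i * T (suc i)) * T i ≈ nat 1) →
                   ∀ k n → n ℕ.< k → convergent a k n ≡ T 0 n
convergent-tails a T a₀≡0 eq (suc k) n (s≤s n≤k) = trans
  (*-identityˡ (p ⁻¹) n)
  (⁻¹-unique-≤ {p} {nat 1 - a 0 * T 1} n
    (λ p₀≡0 → 1≢0 (trans (sym p₀≡1) p₀≡0))
    (λ i i≤n → cong (λ c → nat 1 i ℚ.- c) (*-cong-<ʳ (a 0) {c′} {T 1} (a₀≡0 0) i λ j j<i →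
      convergent-tails (λ i → a (suc i)) (λ i → T (suc i)) (λ i → a₀≡0 (suc i)) (λ i → eq (suc i)) k j
        (ℕ.<-≤-trans j<i (ℕ.≤-trans i≤n n≤k))))
    (eq 0))
  where
  c′ = convergent (λ i → a (suc i)) k
  p = nat 1 - a 0 * c′
  1≢0 : 1ℚ ≢ 0ℚ
  1≢0 ()
  p₀≡1 : p 0 ≡ 1ℚ
  p₀≡1 = trans (cong (λ c → 1ℚ ℚ.- (c ℚ.* c′ 0 ℚ.+ 0ℚ)) (a₀≡0 0))
               (cong (λ c → 1ℚ ℚ.- (c ℚ.+ 0ℚ)) (ℚ.*-zeroˡ (c′ 0)))

-- The candidate values of the tails: from the third on the fraction is periodic with value
-- `catalan`, then `1 - 2xC = δ` yields `1/δ`, and `1 - 2x/δ = (δ - 2x)/δ` yields `δ * D`.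
tails : ℕ → Series
tails 0             = δ * D
tails 1             = δ ⁻¹
tails (suc (suc _)) = catalan

+⇒- : ∀ {f g h} → f ≈ h + g → f - g ≈ h
+⇒- {f} {g} {h} eq n = trans (cong (ℚ._- g n) (eq n))
  (solveℚ 2 (λ a b → (a ⊕ b) ⊖ b ⊜ a) refl (h n) (g n))

δ*δ⁻¹≈1 : δ * δ ⁻¹ ≈ nat 1
δ*δ⁻¹≈1 = *-inverseʳ δ λ ()

tails-eq : ∀ i → (nat 1 - numerators i * tails (suc i)) * tails i ≈ nat 1
tails-eq 0 = begin
  (nat 1 - 2X/δ) * (δ * D)               ≈⟨ *-assoc (nat 1 - 2X/δ) δ D ⟨
  (nat 1 - 2X/δ) * δ * D                 ≈⟨ 𝕊.*-congʳ {D} lemma ⟩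
  (δ - nat 2 * X) * D                    ≈⟨ *-inverseʳ (δ - nat 2 * X) (λ ()) ⟩
  nat 1 ∎
  where
  open ≈-Reasoning
  2X/δ = nat 2 * X * δ ⁻¹
  lemma : (nat 1 - 2X/δ) * δ ≈ δ - nat 2 * X
  lemma = 𝕊.sym (+⇒- (begin
    δ                                 ≈⟨ *-identityˡ δ ⟨
    nat 1 * δ                         ≈⟨ 𝕊.*-congʳ {δ} (-‿+-cancel (nat 1) 2X/δ) ⟨
    ((nat 1 - 2X/δ) + 2X/δ) * δ
      ≈⟨ Semi.solve 4 (λ a t i δ → (a :+ t :* i) :* δ := a :* δ :+ t :* (δ :* i))
           𝕊.refl (nat 1 - 2X/δ) (nat 2 * X) (δ ⁻¹) δ ⟩
    (nat 1 - 2X/δ) * δ + nat 2 * X * (δ * δ ⁻¹)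
      ≈⟨ 𝕊.+-congˡ {(nat 1 - 2X/δ) * δ} (𝕊.*-congˡ {nat 2 * X} δ*δ⁻¹≈1) ⟩
    (nat 1 - 2X/δ) * δ + nat 2 * X * nat 1
      ≈⟨ 𝕊.+-congˡ {(nat 1 - 2X/δ) * δ} (𝕊.*-identityʳ (nat 2 * X)) ⟩
    (nat 1 - 2X/δ) * δ + nat 2 * X  ∎))
tails-eq 1 = 𝕊.trans (𝕊.*-congʳ {δ ⁻¹} {nat 1 - nat 2 * X * catalan} {δ}
  (+⇒- {nat 1} {nat 2 * X * catalan} {δ} (begin
  nat 1                                    ≈⟨ δ+2XC≈1 ⟨
  δ + (X * catalan + X * catalan)          ≈⟨ 𝕊.+-congˡ {δ} (nat-2-* (X * catalan)) ⟨
  δ + nat 2 * (X * catalan)                ≈⟨ 𝕊.+-congˡ {δ} (*-assoc (nat 2) X catalan) ⟨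
  δ + nat 2 * X * catalan                  ∎))) δ*δ⁻¹≈1
  where open ≈-Reasoning
tails-eq (suc (suc i)) = begin
  -- Adding and subtracting `XC²` reduces the claim to `(1 - XC)C + XC² = C = 1 + XC²`.
  (nat 1 - X * C) * C                    ≈⟨ +⇒- {(nat 1 - X * C) * C + X * (C * C)} {X * (C * C)} 𝕊.refl ⟨
  ((nat 1 - X * C) * C + X * (C * C)) - X * (C * C) ≈⟨ +⇒- (begin
     (nat 1 - X * C) * C + X * (C * C)
       ≈⟨ Semi.solve 3 (λ a X C → a :* C :+ X :* (C :* C) := (a :+ X :* C) :* C) 𝕊.refl (nat 1 - X * C) X C ⟩
     ((nat 1 - X * C) + X * C) * C       ≈⟨ 𝕊.*-congʳ {C} (-‿+-cancel (nat 1) (X * C)) ⟩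
     nat 1 * C                           ≈⟨ *-identityˡ C ⟩
     C                                   ≈⟨ catalan-eq ⟩
     nat 1 + X * (C * C)                 ∎) ⟩
  nat 1                                  ∎
  where
  open ≈-Reasoning
  C = catalan

convergents⟶δD : convergent numerators ⟶ δ * D
convergents⟶δD n = suc n , λ k n<k → convergent-tails numerators tails numerators₀ tails-eq k n n<k
  where
  numerators₀ : ∀ i → numerators i 0 ≡ 0ℚ
  numerators₀ 0             = refl
  numerators₀ 1             = refl
  numerators₀ (suc (suc _)) = refl

-- Partially built permutations

filter-reverse : ∀ {A : Set} {P : Pred A 0ℓ} (P? : Decidable P) xs →
                 filter P? (reverse xs) ≡ reverse (filter P? xs)
filter-reverse P? []       = refl
filter-reverse P? (x ∷ xs) = begin
  filter P? (reverse (x ∷ xs))              ≡⟨ cong (filter P?) (List.unfold-reverse x xs) ⟩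
  filter P? (reverse xs ++ [ x ])               ≡⟨ List.filter-++ P? (reverse xs) [ x ] ⟩
  filter P? (reverse xs) ++ filter P? [ x ] ≡⟨ cong (_++ filter P? [ x ]) (filter-reverse P? xs) ⟩
  reverse (filter P? xs) ++ filter P? [ x ] ≡⟨ last ⟩
  reverse (filter P? (x ∷ xs))              ∎
  where
  open ≡-Reasoning
  last : reverse (filter P? xs) ++ filter P? [ x ] ≡ reverse (filter P? (x ∷ xs))
  last with P? x
  ... | yes _ = sym (List.unfold-reverse x (filter P? xs))
  ... | no  _ = List.++-identityʳ _

above : ℕ → List ℕ → List ℕ
above k = filter (k ℕ.≤?_)

above-accept : ∀ {k x} w → k ℕ.≤ x → above k (x ∷ w) ≡ x ∷ above k w
above-accept {k} w = List.filter-accept (k ℕ.≤?_)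

above-reject : ∀ {k x} w → x ℕ.< k → above k (x ∷ w) ≡ above k w
above-reject {k} w x<k = List.filter-reject (k ℕ.≤?_) (ℕ.<⇒≱ x<k)

above-suc-∉ : ∀ {k} w → k ∉ w → above (suc k) w ≡ above k w
above-suc-∉     []      _   = refl
above-suc-∉ {k} (x ∷ w) k∉w with ℕ.<-cmp k x
... | tri< k<x _ _ = trans (above-accept w k<x)
      (trans (cong (x ∷_) (above-suc-∉ w (k∉w ∘ there))) (sym (above-accept w (ℕ.<⇒≤ k<x))))
... | tri≈ _ k≡x _ = contradiction (here k≡x) k∉w
... | tri> _ _ x<k = trans (above-reject w (ℕ.m<n⇒m<1+n x<k))
      (trans (above-suc-∉ w (k∉w ∘ there)) (sym (above-reject w x<k)))

above-suc-above : ∀ k w → above (suc k) (above k w) ≡ above (suc k) w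
above-suc-above k []      = refl
above-suc-above k (x ∷ w) with ℕ.<-cmp k x
... | tri< k<x _ _ = trans (cong (above (suc k)) (above-accept w (ℕ.<⇒≤ k<x)))
      (trans (above-accept (above k w) k<x) (trans (cong (x ∷_) (above-suc-above k w)) (sym (above-accept w k<x))))
... | tri≈ _ refl _ = trans (cong (above (suc k)) (above-accept {k} {k} w ℕ.≤-refl))
      (trans (above-reject (above k w) (ℕ.n<1+n k)) (trans (above-suc-above k w) (sym (above-reject w (ℕ.n<1+n k)))))
... | tri> _ _ x<k = trans (cong (above (suc k)) (above-reject w x<k))
      (trans (above-suc-above k w) (sym (above-reject w (ℕ.m<n⇒m<1+n x<k))))

-- Alternating words of odd length, with a valley at each end. Only the valleys are bounded by `k`,
-- because peaks that are already placed may be `k` or larger.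
data Zigzag (k : ℕ) : List ℕ → Set where
  single : ∀ {v} → v ℕ.< k → Zigzag k (v ∷ [])
  cons   : ∀ {v p v′ w} → v ℕ.< k → v ℕ.< p → v′ ℕ.< p → Zigzag k (v′ ∷ w) → Zigzag k (v ∷ p ∷ v′ ∷ w)

Zigzag-mono : ∀ {k l w} → k ℕ.≤ l → Zigzag k w → Zigzag l w
Zigzag-mono k≤l (single v<k)       = single (ℕ.<-≤-trans v<k k≤l)
Zigzag-mono k≤l (cons v<k v<p q z) = cons (ℕ.<-≤-trans v<k k≤l) v<p q (Zigzag-mono k≤l z)

<-suc-≢ : ∀ {v k} → v ℕ.< suc k → v ≢ k → v ℕ.< k
<-suc-≢ v<1+k = ℕ.≤∧≢⇒< (ℕ.s≤s⁻¹ v<1+k)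

Zigzag-∉ : ∀ {k w} → Zigzag (suc k) w → k ∉ w → Zigzag k w
Zigzag-∉ (single v<)        k∉w = single (<-suc-≢ v< (k∉w ∘ here ∘ sym))
Zigzag-∉ (cons v< v<p q z)  k∉w = cons (<-suc-≢ v< (k∉w ∘ here ∘ sym)) v<p q (Zigzag-∉ z (k∉w ∘ there ∘ there))

Zigzag-∷ʳ : ∀ {k v p v′} w → Zigzag k (w ++ v ∷ []) → v ℕ.< p → v′ ℕ.< p → v′ ℕ.< k →
            Zigzag k (w ++ v ∷ p ∷ v′ ∷ [])
Zigzag-∷ʳ []              (single v<k)      v<p v′<p v′<k = cons v<k v<p v′<p (single v′<k)
Zigzag-∷ʳ (_ ∷ _ ∷ [])    (cons a b c z)    v<p v′<p v′<k = cons a b c (Zigzag-∷ʳ [] z v<p v′<p v′<k)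
Zigzag-∷ʳ (_ ∷ _ ∷ x ∷ w) (cons a b c z)    v<p v′<p v′<k = cons a b c (Zigzag-∷ʳ (x ∷ w) z v<p v′<p v′<k)

Zigzag-reverse : ∀ {k w} → Zigzag k w → Zigzag k (reverse w)
Zigzag-reverse (single v<k) = single v<k
Zigzag-reverse {k} (cons {v} {p} {v′} {w} v<k v<p v′<p z) =
  subst (Zigzag k) (sym (List.ʳ++-defn w))
    (Zigzag-∷ʳ (reverse w) (subst (Zigzag k) (List.unfold-reverse v′ w) (Zigzag-reverse z)) v′<p v<p v<k)

Zigzag-ends : ∀ {k w} → Zigzag k w →
              (∃ λ v → w ≡ [ v ]) ⊎ (∃₂ λ x m → ∃ λ y → w ≡ x ∷ (m ++ [ y ]) × x ℕ.< k × y ℕ.< k)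
Zigzag-ends (single _) = inj₁ (_ , refl)
Zigzag-ends (cons {v} {p} v<k _ _ z) with Zigzag-ends z
... | inj₁ (_ , refl) with single v′<k ← z = inj₂ (_ , [ p ] , _ , refl , v<k , v′<k)
... | inj₂ (x , m , y , refl , _ , y<k)    = inj₂ (_ , p ∷ x ∷ m , y , refl , v<k , y<k)

-- A valley `k` other than the first letter would be preceded by a larger peak, but `k` is the first
-- letter that is at least `k`. If `k` is no valley, all valleys are below `k`.
Zigzag-peak : ∀ {k w st} → Zigzag (suc k) w → Unique w → above k w ≡ k ∷ st →
              (∃ λ w′ → w ≡ k ∷ w′) ⊎ Zigzag k w
Zigzag-peak {k} (single {v} v<1+k) _ _ with v ℕ.≟ k
... | yes refl = inj₁ (_ , refl)
... | no  v≢k  = inj₂ (single (<-suc-≢ v<1+k v≢k))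
Zigzag-peak {k} (cons {v} {p} {v′} {w} v<1+k v<p v′<p z) (_ ∷ p∉ ∷ u) eq with v ℕ.≟ k
... | yes refl = inj₁ (_ , refl)
... | no  v≢k  = inj₂ (cons v<k v<p v′<p rest)
  where
  v<k = <-suc-≢ v<1+k v≢k
  eq′ : above k (p ∷ v′ ∷ w) ≡ k ∷ _
  eq′ = trans (sym (above-reject (p ∷ v′ ∷ w) v<k)) eq
  rest : Zigzag k (v′ ∷ w)
  rest with ℕ.<-≤-connex p k
  ... | inj₁ p<k = [ (λ { (_ , refl) → contradiction v′<p (ℕ.<-asym p<k) }) , id ]′
                   (Zigzag-peak z u (trans (sym (above-reject (v′ ∷ w) p<k)) eq′))
  ... | inj₂ k≤p with refl ← List.∷-injectiveˡ (trans (sym (above-accept (v′ ∷ w) k≤p)) eq′)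
      = Zigzag-∉ z (λ k∈ → All.lookup p∉ k∈ refl)

-- Avoidance of the two patterns

-- An occurrence of 1342 or of 2431.
Forbidden : ℕ → ℕ → ℕ → ℕ → Set
Forbidden a b c d = (a ℕ.< d × d ℕ.< b × b ℕ.< c) ⊎ (d ℕ.< a × a ℕ.< c × c ℕ.< b)

Avoiding : List ℕ → Set
Avoiding w = ∀ {a b c d} → a ∷ b ∷ c ∷ d ∷ [] ⊆ w → ¬ Forbidden a b c d

Avoiding-⊆ : ∀ {v w} → v ⊆ w → Avoiding w → Avoiding v
Avoiding-⊆ v⊆w av p = av (⊆-trans p v⊆w)

-- The reverse of 1342 is 2431, so reversal exchanges the two cases of `Forbidden`.
Avoiding-reverse : ∀ {w} → Avoiding w → Avoiding (reverse w)
Avoiding-reverse {w} av p (inj₁ f) = av (Sublist.reverse⁻ {bs = w} p) (inj₂ f)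
Avoiding-reverse {w} av p (inj₂ f) = av (Sublist.reverse⁻ {bs = w} p) (inj₁ f)

above-ascending : ∀ {k w b c} → AllPairs ℕ._<_ (above k w) → b ∷ c ∷ [] ⊆ w → k ℕ.≤ b → k ℕ.≤ c → b ℕ.< c
above-ascending {k} {w} {b} {c} asc p k≤b k≤c = first asc (subst (_⊆ above k w)
    (List.filter-all (k ℕ.≤?_) (k≤b ∷ k≤c ∷ [])) (Sublist.filter⁺ (k ℕ.≤?_) (k ℕ.≤?_) (λ { refl → id }) p))
  where
  first : ∀ {xs} → AllPairs ℕ._<_ xs → b ∷ c ∷ [] ⊆ xs → b ℕ.< c
  first (_ ∷ asc) (_ ∷ʳ p)   = first asc p
  first (b< ∷ _)  (refl ∷ p) = All.lookup b< (lookup p (here refl))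

-- In both patterns the letters above the first one contain a descent.
Avoiding-∷ : ∀ {k a w} → AllPairs ℕ._<_ (above k w) → k ℕ.≤ a → Avoiding w → Avoiding (a ∷ w)
Avoiding-∷ asc k≤a av (_ ∷ʳ p) f = av p f
Avoiding-∷ {k} {a} {w} asc k≤a av {b = b} {c} {d} (refl ∷ p) (inj₁ (a<d , d<b , b<c)) =
  ℕ.<-asym d<b (above-ascending asc (⊆-trans (refl ∷ c ∷ʳ refl ∷ []) p)
    (ℕ.≤-trans k≤a (ℕ.<⇒≤ (ℕ.<-trans a<d d<b))) (ℕ.≤-trans k≤a (ℕ.<⇒≤ a<d)))
Avoiding-∷ {k} {a} {w} asc k≤a av {b = b} {c} {d} (refl ∷ p) (inj₂ (d<a , a<c , c<b)) =
  ℕ.<-asym c<b (above-ascending asc (⊆-trans (refl ∷ refl ∷ d ∷ʳ []) p)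
    (ℕ.≤-trans k≤a (ℕ.<⇒≤ (ℕ.<-trans a<c c<b))) (ℕ.≤-trans k≤a (ℕ.<⇒≤ a<c)))

-- Orientation convention: the head is the top of the stack and the next value goes to its left. The
-- mirror image, needed only for height 1, is reached through `reverse`.
Stack : ℕ → List ℕ → Set
Stack k st = AllPairs ℕ._<_ st × All (k ℕ.≤_) st

Stack-push : ∀ {k st} → Stack (suc k) st → Stack k (k ∷ st)
Stack-push (asc , k<) = (k< ∷ asc) , (ℕ.≤-refl ∷ All.map ℕ.<⇒≤ k<)

Stack-pop : ∀ {k s st} → Stack (suc k) (s ∷ st) → Stack k st
Stack-pop (_ ∷ asc , _ ∷ k<) = asc , All.map ℕ.<⇒≤ k<

-- States of the construction and their transitions

-- w completes a state in which the values ≥ k have been placed and those still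
-- having an unfilled neighbouring position are the peaks st, from left to right.
record Good (k : ℕ) (st w : List ℕ) : Set where
  constructor good
  field
    zigzag   : Zigzag k w
    unique   : Unique w
    below-∈  : ∀ {x} → x ℕ.< k → x ∈ w
    above-≡  : above k w ≡ st
    avoiding : Avoiding w

open Good

Good-reverse : ∀ {k st w} → Good k st w → Good k (reverse st) (reverse w)
Good-reverse {k} {st} {w} g = good
  (Zigzag-reverse (zigzag g))
  (Permutationₛ.Unique-resp-↭ (setoid ℕ) (↭⇒↭ₛ (↭-sym (↭-reverse w))) (unique g))
  (λ x<k → Any.reverse⁺ (below-∈ g x<k))
  (trans (filter-reverse (k ℕ.≤?_) w) (cong reverse (above-≡ g)))
  (Avoiding-reverse (avoiding g))

-- The word stays the same; only the status of `k` changes, from a waiting peak to a value still to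
-- be placed.
Good-push : ∀ {k st w} → Stack (suc k) st → Good k (k ∷ st) w → Good (suc k) st w
Good-push {k} {st} {w} (_ , k<st) g = good
  (Zigzag-mono (ℕ.n≤1+n k) (zigzag g))
  (unique g)
  below
  (begin
    above (suc k) w              ≡⟨ above-suc-above k w ⟨
    above (suc k) (above k w)    ≡⟨ cong (above (suc k)) (above-≡ g) ⟩
    above (suc k) (k ∷ st)       ≡⟨ above-reject st (ℕ.n<1+n k) ⟩
    above (suc k) st             ≡⟨ List.filter-all (suc k ℕ.≤?_) k<st ⟩
    st                           ∎)
  (avoiding g)
  where
  open ≡-Reasoning
  below : ∀ {x} → x ℕ.< suc k → x ∈ w
  below {x} x<1+k with x ℕ.≟ k
  ... | yes refl = proj₁ (∈-filter⁻ (k ℕ.≤?_) {xs = w} (subst (k ∈_) (sym (above-≡ g)) (here refl)))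
  ... | no  x≢k  = below-∈ g (<-suc-≢ x<1+k x≢k)

-- The letters of `s ∷ w` that are at least `k` form the increasing list `s ∷ st`, so `Avoiding-∷`
-- applies to `s` and then to `k`.
Good-pop : ∀ {k s st w} → Stack (suc k) (s ∷ st) → Good k st w → Good (suc k) (s ∷ st) (k ∷ s ∷ w)
Good-pop {k} {s} {st} {w} (s< ∷ asc , k<s ∷ k<st) g = good
  (zig (zigzag g))
  ((ℕ.<⇒≢ k<s ∷ ∉⇒All k∉w) ∷ ∉⇒All s∉w ∷ unique g)
  below
  (begin
    above (suc k) (k ∷ s ∷ w)   ≡⟨ above-reject (s ∷ w) (ℕ.n<1+n k) ⟩
    above (suc k) (s ∷ w)       ≡⟨ above-accept w k<s ⟩
    s ∷ above (suc k) w         ≡⟨ cong (s ∷_) (trans (above-suc-∉ w k∉w) (above-≡ g)) ⟩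
    s ∷ st                      ∎)
  (Avoiding-∷ {k}
    (subst (AllPairs ℕ._<_) (sym (trans (above-accept w k≤s) (cong (s ∷_) (above-≡ g)))) (s< ∷ asc)) ℕ.≤-refl
    (Avoiding-∷ {k} (subst (AllPairs ℕ._<_) (sym (above-≡ g)) asc) k≤s (avoiding g)))
  where
  open ≡-Reasoning
  k≤s = ℕ.<⇒≤ k<s
  zig : ∀ {w} → Zigzag k w → Zigzag (suc k) (k ∷ s ∷ w)
  zig z@(single v<k)     = cons (ℕ.n<1+n k) k<s (ℕ.<-trans v<k k<s) (Zigzag-mono (ℕ.n≤1+n k) z)
  zig z@(cons v<k _ _ _) = cons (ℕ.n<1+n k) k<s (ℕ.<-trans v<k k<s) (Zigzag-mono (ℕ.n≤1+n k) z)
  ∈-stack : ∀ {x} → k ℕ.≤ x → x ∈ w → x ∈ st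
  ∈-stack k≤x x∈w = subst (_ ∈_) (above-≡ g) (∈-filter⁺ (k ℕ.≤?_) x∈w k≤x)
  k∉w : k ∉ w
  k∉w k∈w = ℕ.<-irrefl refl (All.lookup k<st (∈-stack ℕ.≤-refl k∈w))
  s∉w : s ∉ w
  s∉w s∈w = ℕ.<-irrefl refl (All.lookup s< (∈-stack k≤s s∈w))
  ∉⇒All : ∀ {x} → x ∉ w → All (x ≢_) w
  ∉⇒All x∉w = All.tabulate λ { y∈w refl → x∉w y∈w }
  below : ∀ {x} → x ℕ.< suc k → x ∈ k ∷ s ∷ w
  below {x} x<1+k with x ℕ.≟ k
  ... | yes refl = here refl
  ... | no  x≢k  = there (there (below-∈ g (<-suc-≢ x<1+k x≢k)))

-- The peak next to the leading valley `k` is the leftmost letter above `k`, hence the top `s` of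
-- the stack.
Good-unpop : ∀ {k s st w} → Good (suc k) (s ∷ st) (k ∷ w) → ∃ λ w′ → w ≡ s ∷ w′ × Good k st w′
Good-unpop {k} g with zigzag g
... | single _ with () ← trans (sym (above-reject [] (ℕ.n<1+n k))) (above-≡ g)
Good-unpop {k} {s} {st} g | cons {p = p} {v′} {w} _ k<p _ z
  with unique g
... | k∉@(_ ∷ k∉w) ∷ p∉w ∷ u
  with eq ← trans (sym (above-accept (v′ ∷ w) k<p)) 
      (trans (sym (above-reject (p ∷ v′ ∷ w) (ℕ.n<1+n k))) (above-≡ g))
  with refl ← List.∷-injectiveˡ eq
  = v′ ∷ w , refl , good
    (Zigzag-∉ z k∉w′)
    u
    below
    (trans (sym (above-suc-∉ (v′ ∷ w) k∉w′)) (List.∷-injectiveʳ eq))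
    (Avoiding-⊆ (k ∷ʳ p ∷ʳ ⊆-refl) (avoiding g))
  where
  k∉w′ : k ∉ v′ ∷ w
  k∉w′ k∈ = All.lookup k∉w k∈ refl
  below : ∀ {x} → x ℕ.< k → x ∈ v′ ∷ w
  below x<k with below-∈ g (ℕ.m<n⇒m<1+n x<k)
  ... | here refl         = contradiction x<k (ℕ.<-irrefl refl)
  ... | there (here refl) = contradiction x<k (ℕ.<-asym k<p)
  ... | there (there x∈w) = x∈w

Good-unpush : ∀ {k st w} → Good (suc k) st w → Zigzag k w → above k w ≡ k ∷ st → Good k (k ∷ st) w
Good-unpush g z eq = good z (unique g) (below-∈ g ∘ ℕ.m<n⇒m<1+n) eq (avoiding g)

-- Locates `k` among the waiting peaks; `words-complete` splits into cases by the part `pre` to its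
-- left.
above-insert : ∀ {k st w} → Good (suc k) st w →
               ∃₂ λ pre post → above k w ≡ pre ++ k ∷ post × pre ++ post ≡ st
above-insert {k} {st} {w} g with ∈-∃++ (below-∈ g (ℕ.n<1+n k))
... | w₁ , w₂ , refl = above k w₁ , above k w₂
  , trans (List.filter-++ (k ℕ.≤?_) w₁ (k ∷ w₂)) (cong (above k w₁ ++_) (above-accept w₂ ℕ.≤-refl))
  , (begin
      above k w₁ ++ above k w₂                    ≡⟨ cong₂ _++_ (above-suc-∉ w₁ k∉w₁) (above-suc-∉ w₂ k∉w₂) ⟨
      above (suc k) w₁ ++ above (suc k) w₂        ≡⟨ cong (above (suc k) w₁ ++_) (above-reject w₂ (ℕ.n<1+n k)) ⟨
      above (suc k) w₁ ++ above (suc k) (k ∷ w₂)  ≡⟨ List.filter-++ (suc k ℕ.≤?_) w₁ (k ∷ w₂) ⟨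
      above (suc k) (w₁ ++ k ∷ w₂)                ≡⟨ above-≡ g ⟩
      st                                          ∎)
  where
  open ≡-Reasoning
  split : ∀ w₁ → Unique (w₁ ++ k ∷ w₂) → k ∉ w₁ × k ∉ w₂
  split []       (k∉ ∷ _) = (λ ()) , λ k∈ → All.lookup k∉ k∈ refl
  split (x ∷ w₁) (x∉ ∷ u) with split w₁ u
  ... | p , q = (λ { (here refl) → All.lookup x∉ (∈-++⁺ʳ w₁ (here refl)) refl ; (there k∈) → p k∈ }) , q
  k∉w₁ = proj₁ (split w₁ (unique g))
  k∉w₂ = proj₂ (split w₁ (unique g))

-- Being different from the end letters, `a` and `b` lie strictly inside, so the two ends extend
-- them to a candidate for a forbidden pattern.
⊆-interior : ∀ {a b x y : ℕ} m → a ≢ x → b ≢ y → a ∷ b ∷ [] ⊆ x ∷ (m ++ [ y ]) →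
             x ∷ a ∷ b ∷ y ∷ [] ⊆ x ∷ (m ++ [ y ])
⊆-interior {a} {b} {x} {y} m a≢x b≢y p = refl ∷ Sublist.++⁺ interior (⊆-refl {x = [ y ]})
  where
  interior : a ∷ b ∷ [] ⊆ m
  interior = Sublist.reverse⁻ (Sublist.∷ʳ⁻ b≢y (subst (b ∷ a ∷ [] ⊆_) (List.reverse-++ m [ y ])
    (Sublist.reverse⁺ (Sublist.∷ʳ⁻ a≢x p))))

-- If k lies to the right of s, the first letter x and the last letter y of w
-- form a forbidden pattern around s s′ (if x < y) or around s k (if x > y).
¬after-stack : ∀ {k s s′ st w pre post} → Stack (suc k) (s ∷ s′ ∷ st) → Good (suc k) (s ∷ s′ ∷ st) w →
               above k w ≢ s ∷ pre ++ k ∷ post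
¬after-stack {k} {s} {s′} {st} {w} {pre} {post} ((s<s′ ∷ _) ∷ _ , k<s ∷ k<s′ ∷ _) g eq
  with Zigzag-ends (zigzag g)
... | inj₁ (v , refl) with above (suc k) [ v ] | List.length-filter (suc k ℕ.≤?_) [ v ] | above-≡ g
...   | _ | s≤s () | refl
¬after-stack {k} {s} {s′} {st} {w} {pre} {post} ((s<s′ ∷ _) ∷ _ , k<s ∷ k<s′ ∷ _) g eq
    | inj₂ (x , m , y , refl , x<1+k , y<1+k) with ℕ.<-cmp x y
... | tri< x<y _ _ = contradiction
        (inj₁ (x<y , ℕ.<-≤-trans y<1+k k<s , s<s′))
        (avoiding g (⊆-interior m (ℕ.>⇒≢ x<s) (ℕ.>⇒≢ (ℕ.<-≤-trans y<1+k k<s′)) ss′⊆w))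
  where
  x<s = ℕ.<-≤-trans x<1+k k<s
  ss′⊆w : s ∷ s′ ∷ [] ⊆ x ∷ (m ++ [ y ])
  ss′⊆w = ⊆-trans (refl ∷ refl ∷ Sublist.[]⊆-universal st)
    (subst (_⊆ x ∷ (m ++ [ y ])) (above-≡ g) (Sublist.filter-⊆ (suc k ℕ.≤?_) (x ∷ (m ++ [ y ]))))
... | tri≈ _ refl _ with x∉ ∷ _ ← unique g = contradiction refl (All.lookup x∉ (∈-++⁺ʳ m (here refl)))
... | tri> _ _ y<x = contradiction
        (inj₂ (y<x , x<k , k<s))
        (avoiding g (⊆-interior m (ℕ.>⇒≢ x<s) (ℕ.>⇒≢ (ℕ.<-trans y<x x<k)) sk⊆w))
  where
  x<s = ℕ.<-≤-trans x<1+k k<s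
  sk⊆w : s ∷ k ∷ [] ⊆ x ∷ (m ++ [ y ])
  sk⊆w = ⊆-trans (refl ∷ Sublist.++⁺ˡ pre (refl ∷ Sublist.[]⊆-universal post))
    (subst (_⊆ x ∷ (m ++ [ y ])) eq (Sublist.filter-⊆ (k ℕ.≤?_) (x ∷ (m ++ [ y ]))))
  x≢k : x ≢ k
  x≢k refl with x∉ ∷ _ ← unique g =
    All.lookup x∉ (lookup (Sublist.∷ʳ⁻ (ℕ.>⇒≢ x<s) sk⊆w) (there (here refl))) refl
  x<k = <-suc-≢ x<1+k x≢k

-- Enumeration of the completions

-- words k st lists the w with Good k st w; those in leftward k s st have k to the
-- left of s, either as a new peak or as the valley preceding s.
words    : ℕ → List ℕ → List (List ℕ)
leftward : ℕ → ℕ → List ℕ → List (List ℕ)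

words zero          _             = []
words (suc k)       (s ∷ [])      = leftward k s [] ++ map reverse (leftward k s [])
words (suc k)       (s ∷ s′ ∷ st) = leftward k s (s′ ∷ st)
words (suc zero)    []            = [ [ 0 ] ]
words (suc (suc k)) []            = words (suc k) [ suc k ]

leftward k s st = words k (k ∷ s ∷ st) ++ map (λ w → k ∷ s ∷ w) (words k st)

length-words : ∀ k st → length (words k st) ≡ pathCount k (length st)
length-leftward : ∀ k s st → length (leftward k s st) ≡ pathCount k (2 ℕ.+ length st) ℕ.+ pathCount k (length st)

length-words zero          _             = refl
length-words (suc zero)    []            = refl
length-words (suc (suc k)) []            = length-words (suc k) [ suc k ]
length-words (suc k)       (s ∷ [])      = trans (List.length-++ (leftward k s []))
  (cong₂ ℕ._+_ (length-leftward k s [])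
    (trans (List.length-map reverse (leftward k s [])) (length-leftward k s [])))
length-words (suc k)       (s ∷ s′ ∷ st) = length-leftward k s (s′ ∷ st)

length-leftward k s st = trans (List.length-++ (words k (k ∷ s ∷ st)))
  (cong₂ ℕ._+_ (length-words k (k ∷ s ∷ st)) (trans (List.length-map _ (words k st)) (length-words k st)))

Stack-singleton : ∀ k → Stack k [ k ]
Stack-singleton k = ([] ∷ []) , (ℕ.≤-refl ∷ [])

words-sound : ∀ k st {w} → Stack k st → w ∈ words k st → Good k st w
-- The second component records that `k` stands to the left of `s`; `words-unique` uses it to
-- separate these words from their reversals.
leftward-sound : ∀ k s st {w} → Stack (suc k) (s ∷ st) → w ∈ leftward k s st →
                 Good (suc k) (s ∷ st) w × above k w ≡ k ∷ s ∷ st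

words-sound (suc zero)    []            _ (here refl) =
  good (single (s≤s z≤n)) ([] ∷ []) (λ { (s≤s z≤n) → here refl }) refl λ { (_ ∷ʳ ()) ; (_ ∷ ()) }
words-sound (suc (suc k)) []            _ w∈ =
  Good-push ([] , []) (words-sound (suc k) [ suc k ] (Stack-singleton (suc k)) w∈)
words-sound (suc k)       (s ∷ [])      S w∈ with ∈-++⁻ (leftward k s []) w∈
... | inj₁ w∈ˡ = proj₁ (leftward-sound k s [] S w∈ˡ)
... | inj₂ w∈ʳ with v , v∈ , refl ← ∈-map⁻ reverse w∈ʳ = Good-reverse (proj₁ (leftward-sound k s [] S v∈))
words-sound (suc k)       (s ∷ s′ ∷ st) S w∈ = proj₁ (leftward-sound k s (s′ ∷ st) S w∈)

leftward-sound k s st S w∈ with ∈-++⁻ (words k (k ∷ s ∷ st)) w∈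
... | inj₁ w∈push with g ← words-sound k (k ∷ s ∷ st) (Stack-push S) w∈push = Good-push S g , above-≡ g
... | inj₂ w∈pop  with v , v∈ , refl ← ∈-map⁻ (λ w → k ∷ s ∷ w) w∈pop
                  with g ← words-sound k st (Stack-pop S) v∈
                  with _ , k<s ∷ _ ← S
  = Good-pop S g , trans (above-accept (s ∷ v) ℕ.≤-refl)
      (cong (k ∷_) (trans (above-accept v (ℕ.<⇒≤ k<s)) (cong (s ∷_) (above-≡ g))))

¬Good-0 : ∀ {st w} → ¬ Good 0 st w
¬Good-0 g with zigzag g
... | single ()
... | cons () _ _ _

-- First `above-insert` places `k` relative to the stack, with `¬after-stack` excluding the wrong
-- side when two or more peaks wait. Then `Zigzag-peak` decides between a peak (push) and a leading
-- valley (pop).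
words-complete : ∀ k st {w} → Stack k st → Good k st w → w ∈ words k st
leftward-complete : ∀ k s st {w} → Stack (suc k) (s ∷ st) → Good (suc k) (s ∷ st) w →
                    above k w ≡ k ∷ s ∷ st → w ∈ leftward k s st

words-complete zero _ _ g = contradiction g ¬Good-0
words-complete (suc k) [] S g with above-insert g
... | [] , [] , eq , refl with Zigzag-peak (zigzag g) (unique g) eq
-- The value 0 cannot be a peak, as no valley lies below it.
words-complete (suc zero)    [] S g | [] , [] , eq , refl | inj₂ z =
  contradiction (Good-unpush g z eq) ¬Good-0
words-complete (suc (suc k)) [] S g | [] , [] , eq , refl | inj₂ z =
  words-complete (suc k) [ suc k ] (Stack-singleton (suc k)) (Good-unpush g z eq)
words-complete (suc k) [] S g | [] , [] , eq , refl | inj₁ (w , refl) = only k (zigzag g) (above-≡ g) (below-∈ g)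
  where
  -- With an empty stack a leading valley `k` is the whole word, since a peak next to it would
  -- exceed `k` and be waiting. A single letter covers all values up to `k` only for `k = 0`.
  only : ∀ k {w} → Zigzag (suc k) (k ∷ w) → above (suc k) (k ∷ w) ≡ [] → (∀ {x} → x ℕ.< suc k → x ∈ k ∷ w) →
         k ∷ w ∈ words (suc k) []
  only zero    (single _) _ _ = here refl
  only (suc k) (single _) _ below with below (s≤s (z≤n {suc k}))
  ... | here ()
  ... | there ()
  only k (cons {p = p} {v′} {w} _ k<p _ _) eq _
    with () ← trans (sym (above-accept (v′ ∷ w) k<p)) (trans (sym (above-reject (p ∷ v′ ∷ w) (ℕ.n<1+n k))) eq)
words-complete (suc k) (s ∷ []) {w} S g with above-insert g
... | []     , _  , eq , refl = ∈-++⁺ˡ (leftward-complete k s [] S g eq)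
-- Here `k` stands to the right of the only waiting peak, so the reversed word falls under the
-- leftward case.
... | _ ∷ [] , [] , eq , refl = ∈-++⁺ʳ (leftward k s []) (subst (_∈ map reverse (leftward k s []))
        (List.reverse-involutive w) (∈-map⁺ reverse (leftward-complete k s [] S (Good-reverse g)
          (trans (filter-reverse (k ℕ.≤?_) w) (cong reverse eq)))))
words-complete (suc k) (s ∷ s′ ∷ st) S g with above-insert g
... | []     , _ , eq , refl = leftward-complete k s (s′ ∷ st) S g eq
... | _ ∷ pre , post , eq , eq′ with refl ← List.∷-injectiveˡ eq′ =
  contradiction eq (¬after-stack {pre = pre} {post} S g)

leftward-complete k s st S g eq with Zigzag-peak (zigzag g) (unique g) eq
... | inj₂ z = ∈-++⁺ˡ (words-complete k (k ∷ s ∷ st) (Stack-push S) (Good-unpush g z eq))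
... | inj₁ (_ , refl) with _ , refl , g′ ← Good-unpop g =
  ∈-++⁺ʳ (words k (k ∷ s ∷ st)) (∈-map⁺ (λ w → k ∷ s ∷ w) (words-complete k st (Stack-pop S) g′))

words-unique : ∀ k st → Stack k st → Unique (words k st)
leftward-unique : ∀ k s st → Stack (suc k) (s ∷ st) → Unique (leftward k s st)

words-unique zero          _             _ = []
words-unique (suc zero)    []            _ = [] ∷ []
words-unique (suc (suc k)) []            _ = words-unique (suc k) [ suc k ] (Stack-singleton (suc k))
words-unique (suc k)       (s ∷ [])      S@(_ , k<s ∷ _) =
  Unique.++⁺ (leftward-unique k s [] S) (Unique.map⁺ List.reverse-injective (leftward-unique k s [] S)) disjoint
  where
  -- The order in which `k` and `s` occur tells the two halves apart.
  disjoint : Disjoint (leftward k s []) (map reverse (leftward k s []))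
  disjoint (w∈ , w∈ʳ) with v , v∈ , refl ← ∈-map⁻ reverse w∈ʳ
    = ℕ.<⇒≢ k<s (List.∷-injectiveˡ (begin
        k ∷ s ∷ []          ≡⟨ proj₂ (leftward-sound k s [] S w∈) ⟨
        above k (reverse v) ≡⟨ filter-reverse (k ℕ.≤?_) v ⟩
        reverse (above k v) ≡⟨ cong reverse (proj₂ (leftward-sound k s [] S v∈)) ⟩
        s ∷ k ∷ []          ∎))
    where open ≡-Reasoning
words-unique (suc k)       (s ∷ s′ ∷ st) S = leftward-unique k s (s′ ∷ st) S

leftward-unique k s st S = Unique.++⁺
  (words-unique k (k ∷ s ∷ st) (Stack-push S))
  (Unique.map⁺ (λ eq → List.∷-injectiveʳ (List.∷-injectiveʳ eq)) (words-unique k st (Stack-pop S)))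
  disjoint
  where
  -- After a push the first letter is a valley below `k`; after a pop it is `k` itself.
  disjoint : Disjoint (words k (k ∷ s ∷ st)) (map (λ w → k ∷ s ∷ w) (words k st))
  disjoint (w∈ , w∈pop) with _ , _ , refl ← ∈-map⁻ (λ w → k ∷ s ∷ w) w∈pop
    with zigzag (words-sound k (k ∷ s ∷ st) (Stack-push S) w∈)
  ... | cons k<k _ _ _ = ℕ.<-irrefl refl k<k

-- Permutations as lists

-- Pigeonhole principle, by removing the first entry of `xs` from both lists.
Unique-⊆-length : ∀ {A : Set} {xs ys : List A} → Unique xs → (∀ {x} → x ∈ xs → x ∈ ys) → length xs ℕ.≤ length ys
Unique-⊆-length {xs = []} _ _ = z≤n
Unique-⊆-length {xs = x ∷ xs} {ys} (x∉xs ∷ u) xs⊆ys with ∈-∃++ (xs⊆ys (here refl))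
... | ys₁ , ys₂ , refl = begin
  suc (length xs)                 ≤⟨ s≤s (Unique-⊆-length u remove) ⟩
  suc (length (ys₁ ++ ys₂))       ≡⟨ cong suc (List.length-++ ys₁) ⟩
  suc (length ys₁ ℕ.+ length ys₂) ≡⟨ ℕ.+-suc (length ys₁) (length ys₂) ⟨
  length ys₁ ℕ.+ suc (length ys₂) ≡⟨ List.length-++ ys₁ ⟨
  length (ys₁ ++ x ∷ ys₂)         ∎
  where
  open ℕ.≤-Reasoning
  remove : ∀ {y} → y ∈ xs → y ∈ ys₁ ++ ys₂
  remove y∈xs with ∈-++⁻ ys₁ (xs⊆ys (there y∈xs))
  ... | inj₁ y∈          = ∈-++⁺ˡ y∈
  ... | inj₂ (here refl) = contradiction refl (All.lookup x∉xs y∈xs)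
  ... | inj₂ (there y∈)  = ∈-++⁺ʳ ys₁ y∈

letters : ∀ {m k} → Word m k → List ℕ
letters []      = []
letters (x ∷ π) = toℕ x ∷ letters π

length-letters : ∀ {m k} (π : Word m k) → length (letters π) ≡ k
length-letters []      = refl
length-letters (x ∷ π) = cong suc (length-letters π)

letters-injective : ∀ {m k} {π ρ : Word m k} → letters π ≡ letters ρ → π ≡ ρ
letters-injective {π = []}    {[]}    _  = refl
letters-injective {π = _ ∷ _} {_ ∷ _} eq =
  cong₂ _∷_ (Fin.toℕ-injective (List.∷-injectiveˡ eq)) (letters-injective (List.∷-injectiveʳ eq))

letters-< : ∀ {m k} (π : Word m k) → All (ℕ._< m) (letters π)
letters-< []      = []
letters-< (x ∷ π) = Fin.toℕ<n x ∷ letters-< π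

fromLetters : ∀ {m k} w → length w ≡ k → All (ℕ._< m) w → ∃ λ (π : Word m k) → letters π ≡ w
fromLetters []      refl []         = [] , refl
fromLetters (x ∷ w) refl (x<m ∷ w<) with π , eq ← fromLetters w refl w< =
  fromℕ< x<m ∷ π , cong₂ _∷_ (Fin.toℕ-fromℕ< x<m) eq

Unique-letters⁺ : ∀ {m k} {π : Word m k} → Vecᵘ.Unique π → Unique (letters π)
Unique-letters⁺ {π = []}    []        = []
Unique-letters⁺ {π = x ∷ π} (x∉ ∷ u) = go π x∉ ∷ Unique-letters⁺ u
  where
  go : ∀ {k} (π : Word _ k) → Vecᵃ.All (x ≢_) π → All (toℕ x ≢_) (letters π)
  go []      []           = []
  go (y ∷ π) (x≢y ∷ x∉)   = (x≢y ∘ Fin.toℕ-injective) ∷ go π x∉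

Unique-letters⁻ : ∀ {m k} {π : Word m k} → Unique (letters π) → Vecᵘ.Unique π
Unique-letters⁻ {π = []}    []        = []
Unique-letters⁻ {π = x ∷ π} (x∉ ∷ u) = go π x∉ ∷ Unique-letters⁻ u
  where
  go : ∀ {k} (π : Word _ k) → All (toℕ x ≢_) (letters π) → Vecᵃ.All (x ≢_) π
  go []      []           = []
  go (y ∷ π) (x≢y ∷ x∉)   = (x≢y ∘ cong toℕ) ∷ go π x∉

-- The odd length makes the last letter a valley. It is given by an equation, so that matching on
-- `n` peels off two letters at a time.
UpDown⇒Zigzag : ∀ {m k} n → k ≡ suc (double n) → (π : Word m k) → UpDown π → Zigzag m (letters π)
UpDown⇒Zigzag zero    refl (x ∷ [])        _                = single (Fin.toℕ<n x)
UpDown⇒Zigzag (suc n) refl (x ∷ y ∷ z ∷ π) (x<y , z<y , ud) =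
  cons (Fin.toℕ<n x) x<y z<y (UpDown⇒Zigzag n refl (z ∷ π) ud)

Zigzag⇒UpDown : ∀ {m k} (π : Word m k) → Zigzag m (letters π) → UpDown π
Zigzag⇒UpDown (x ∷ [])        _                    = tt
Zigzag⇒UpDown (x ∷ y ∷ z ∷ π) (cons _ x<y z<y zig) = x<y , z<y , Zigzag⇒UpDown (z ∷ π) zig

-- Pattern occurrences as sublists

lookup-mono-< : ∀ {n} {ys : Vec ℕ n} → Vecᵖ.AllPairs ℕ._<_ ys → ∀ {i j} → i Fin.< j →
                Vec.lookup ys i ℕ.< Vec.lookup ys j
lookup-mono-< (y< ∷ _)  {zero}  {suc j} _         = Vecᵃ.lookup⁺ y< j
lookup-mono-< (_ ∷ asc) {suc i} {suc j} (s≤s i<j) = lookup-mono-< asc i<j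

rank : ∀ {n} → Fin n → ℕ
rank i = suc (toℕ i)

-- The pattern is given by the ranks ρ of its letters, and ys lists the letters
-- of the occurrence in increasing order.
orderIsomorphic : ∀ {l n m k} (ρ : Vec (Fin n) l) {ys : Vec ℕ n} → Vecᵖ.AllPairs ℕ._<_ ys →
                  (π : Word m k) (p : Word k l) →
                  (∀ i → toℕ (Vec.lookup π (Vec.lookup p i)) ≡ Vec.lookup ys (Vec.lookup ρ i)) →
                  OrderIsomorphic (Vec.map rank ρ) π p
orderIsomorphic ρ {ys} asc π p eq a b
  rewrite Vec.lookup-map a rank ρ | Vec.lookup-map b rank ρ | eq a | eq b
  = (λ { (s≤s ρ<) → lookup-mono-< asc ρ< }) , converse
  where
  i = Vec.lookup ρ a
  j = Vec.lookup ρ b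
  converse : Vec.lookup ys i ℕ.< Vec.lookup ys j → suc (toℕ i) ℕ.< suc (toℕ j)
  converse lt with Fin.<-cmp i j
  ... | tri< i<j _ _ = s≤s i<j
  ... | tri≈ _ i≡j _ = contradiction lt (ℕ.<-irrefl (cong (Vec.lookup ys) i≡j))
  ... | tri> _ _ j<i = contradiction lt (ℕ.<-asym (lookup-mono-< asc j<i))

⊆⇒positions : ∀ {m k xs} (π : Word m k) → xs ⊆ letters π →
              ∃ λ (p : Word k (length xs)) → Vecᵖ.AllPairs Fin._<_ p ×
                (∀ i → toℕ (Vec.lookup π (Vec.lookup p i)) ≡ List.lookup xs i)
⊆⇒positions []      []       = [] , [] , λ ()
⊆⇒positions (x ∷ π) (_ ∷ʳ q) with p , asc , eq ← ⊆⇒positions π q =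
  Vec.map suc p , Vecᵖ.map⁺ (Vecᵖ.map s≤s asc) ,
  λ i → trans (cong (toℕ ∘ Vec.lookup (x ∷ π)) (Vec.lookup-map i suc p)) (eq i)
⊆⇒positions (x ∷ π) (refl ∷ q) with p , asc , eq ← ⊆⇒positions π q =
  zero ∷ Vec.map suc p , (0< p ∷ Vecᵖ.map⁺ (Vecᵖ.map s≤s asc)) ,
  λ { zero → refl ; (suc i) → trans (cong (toℕ ∘ Vec.lookup (x ∷ π)) (Vec.lookup-map i suc p)) (eq i) }
  where
  0< : ∀ {k l} (p : Word k l) → Vecᵃ.All (zero {k} Fin.<_) (Vec.map suc p)
  0< []      = []
  0< (_ ∷ p) = s≤s z≤n ∷ 0< p

-- Induction on `π`: its first letter either opens the occurrence or is skipped. In both cases the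
-- remaining positions are nonzero, hence shifts by `suc` of positions in the rest of the word.
positions⇒⊆ : ∀ {m k l} (π : Word m k) (p : Word k l) → Vecᵖ.AllPairs Fin._<_ p →
              letters (Vec.map (Vec.lookup π) p) ⊆ letters π
positions⇒⊆ π       []      _ = Sublist.[]⊆-universal (letters π)
positions⇒⊆ []      (() ∷ _)
positions⇒⊆ {k = suc k} (x ∷ π) (i ∷ p) (i< ∷ asc) = go i i< asc
  where
  unsuc : ∀ {l} (p : Word (suc k) l) → Vecᵃ.All (zero {k} Fin.<_) p → ∃ λ p′ → p ≡ Vec.map suc p′
  unsuc []          []       = [] , refl
  unsuc (suc i ∷ p) (_ ∷ 0<) with p′ , refl ← unsuc p 0< = i ∷ p′ , refl
  unmap : ∀ {l} (p : Word k l) → Vec.map (Vec.lookup (x ∷ π)) (Vec.map suc p) ≡ Vec.map (Vec.lookup π) p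
  unmap p = sym (Vec.map-∘ (Vec.lookup (x ∷ π)) suc p)
  AllPairs-suc⁻ : ∀ {l} (p : Word k l) → Vecᵖ.AllPairs Fin._<_ (Vec.map suc p) → Vecᵖ.AllPairs Fin._<_ p
  All-suc⁻ : ∀ {l i} (p : Word k l) → Vecᵃ.All (suc i Fin.<_) (Vec.map suc p) → Vecᵃ.All (i Fin.<_) p
  All-suc⁻ []      []       = []
  All-suc⁻ (_ ∷ p) (s≤s i<j ∷ i<) = i<j ∷ All-suc⁻ p i<
  AllPairs-suc⁻ []      []         = []
  AllPairs-suc⁻ (_ ∷ p) (i< ∷ asc) = All-suc⁻ p i< ∷ AllPairs-suc⁻ p asc
  go : ∀ i → Vecᵃ.All (i Fin.<_) p → Vecᵖ.AllPairs Fin._<_ p →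
       letters (Vec.map (Vec.lookup (x ∷ π)) (i ∷ p)) ⊆ toℕ x ∷ letters π
  go zero i< asc with p′ , refl ← unsuc p i< =
    refl ∷ subst (λ q → letters q ⊆ letters π) (sym (unmap p′)) (positions⇒⊆ π p′ (AllPairs-suc⁻ p′ asc))
  go (suc i) i< asc with p′ , refl ← unsuc p (Vecᵃ.map (λ {j} → ℕ.<-trans {0} (s≤s z≤n)) i<) =
    toℕ x ∷ʳ subst (λ q → letters (Vec.lookup π i ∷ q) ⊆ letters π) (sym (unmap p′))
      (positions⇒⊆ π (i ∷ p′) (All-suc⁻ p′ i< ∷ AllPairs-suc⁻ p′ asc))

Avoids⇒Avoiding : ∀ {m k} (π : Word m k) → Avoids p1342 π → Avoids p2431 π → Avoiding (letters π)
Avoids⇒Avoiding π av₁ av₂ {a} {b} {c} {d} q f with ⊆⇒positions π q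
Avoids⇒Avoiding π av₁ av₂ {a} {b} {c} {d} q (inj₁ (a<d , d<b , b<c)) | p , asc , eq =
  -- `rank` adds 1, so the ranks 0, 2, 3, 1 encode 1342; sorted, the four letters are `a`, `d`, `b`,
  -- `c`.
  av₁ (p , asc , orderIsomorphic (0F ∷ 2F ∷ 3F ∷ 1F ∷ []) {a ∷ d ∷ b ∷ c ∷ []}
    ((a<d ∷ ℕ.<-trans a<d d<b ∷ ℕ.<-trans a<d (ℕ.<-trans d<b b<c) ∷ [])
      ∷ (d<b ∷ ℕ.<-trans d<b b<c ∷ []) ∷ (b<c ∷ []) ∷ [] ∷ []) π p
    λ { 0F → eq 0F ; 1F → eq 1F ; 2F → eq 2F ; 3F → eq 3F })
Avoids⇒Avoiding π av₁ av₂ {a} {b} {c} {d} q (inj₂ (d<a , a<c , c<b)) | p , asc , eq =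
  av₂ (p , asc , orderIsomorphic (1F ∷ 3F ∷ 2F ∷ 0F ∷ []) {d ∷ a ∷ c ∷ b ∷ []}
    ((d<a ∷ ℕ.<-trans d<a a<c ∷ ℕ.<-trans d<a (ℕ.<-trans a<c c<b) ∷ [])
      ∷ (a<c ∷ ℕ.<-trans a<c c<b ∷ []) ∷ (c<b ∷ []) ∷ [] ∷ []) π p
    λ { 0F → eq 0F ; 1F → eq 1F ; 2F → eq 2F ; 3F → eq 3F })

Avoiding⇒Avoids-1342 : ∀ {m k} (π : Word m k) → Avoiding (letters π) → Avoids p1342 π
Avoiding⇒Avoids-1342 π av (p@(_ ∷ _ ∷ _ ∷ _ ∷ []) , asc , iso) = av (positions⇒⊆ π p asc)
  (inj₁ (proj₁ (iso 0F 3F) (s≤s (s≤s z≤n)) , proj₁ (iso 3F 1F) (s≤s (s≤s (s≤s z≤n))) ,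
         proj₁ (iso 1F 2F) (s≤s (s≤s (s≤s (s≤s z≤n))))))

Avoiding⇒Avoids-2431 : ∀ {m k} (π : Word m k) → Avoiding (letters π) → Avoids p2431 π
Avoiding⇒Avoids-2431 π av (p@(_ ∷ _ ∷ _ ∷ _ ∷ []) , asc , iso) = av (positions⇒⊆ π p asc)
  (inj₂ (proj₁ (iso 3F 0F) (s≤s (s≤s z≤n)) , proj₁ (iso 0F 2F) (s≤s (s≤s (s≤s z≤n))) ,
         proj₁ (iso 2F 1F) (s≤s (s≤s (s≤s (s≤s z≤n))))))

-- This is the initial state, in which no value has been placed and no peak is waiting.
𝔄⇒Good : ∀ {m} n {π} → m ≡ suc (double n) → 𝔄 m π → Good m [] (letters π)
𝔄⇒Good {m} n {π} odd (perm , ud , av₁ , av₂) = good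
  (UpDown⇒Zigzag n odd π ud)
  (Unique-letters⁺ perm)
  below
  (List.filter-none (m ℕ.≤?_) (All.map ℕ.<⇒≱ (letters-< π)))
  (Avoids⇒Avoiding π av₁ av₂)
  where
  -- A missing value together with the letters of `π` would give `m + 1` distinct numbers below `m`.
  below : ∀ {x} → x ℕ.< m → x ∈ letters π
  below {x} x<m with _∈?_ ℕ._≟_ x (letters π)
  ... | yes x∈ = x∈
  ... | no  x∉ = contradiction
    (subst₂ ℕ._≤_ (cong suc (length-letters π)) (List.length-upTo m)
      (Unique-⊆-length {xs = x ∷ letters π} {List.upTo m}
        (All.tabulate (λ { y∈ refl → x∉ y∈ }) ∷ Unique-letters⁺ perm)
        λ { (here refl) → ∈-upTo⁺ x<m ; (there y∈) → ∈-upTo⁺ (All.lookup (letters-< π) y∈) }))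
    (ℕ.<-irrefl refl)

Good⇒𝔄 : ∀ {m w} → Good m [] w → ∃ λ π → letters π ≡ w × 𝔄 m π
Good⇒𝔄 {m} {w} g with fromLetters w length≡ w<
  where
  w< : All (ℕ._< m) w
  w< = All.tabulate λ {x} x∈w → ℕ.≰⇒> λ m≤x →
    contradiction (subst (x ∈_) (above-≡ g) (∈-filter⁺ (m ℕ.≤?_) x∈w m≤x)) λ ()
  length≡ : length w ≡ m
  length≡ = trans (ℕ.≤-antisym
    (Unique-⊆-length (unique g) (∈-upTo⁺ ∘ All.lookup w<))
    (Unique-⊆-length (Unique.upTo⁺ m) (below-∈ g ∘ ∈-upTo⁻))) (List.length-upTo m)
... | π , refl = π , refl , Unique-letters⁻ (unique g) , Zigzag⇒UpDown π (zigzag g)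
  , Avoiding⇒Avoids-1342 π (avoiding g) , Avoiding⇒Avoids-2431 π (avoiding g)

-- Cardinality of the avoidance class

∈-allWords : ∀ {m k} (π : Word m k) → π ∈ allWords m k
∈-allWords []      = here refl
∈-allWords (x ∷ π) = ∈-cartesianProductWith⁺ _∷_ (∈-allFin x) (∈-allWords π)

allWords-unique : ∀ m k → Unique (allWords m k)
allWords-unique m zero    = [] ∷ []
allWords-unique m (suc k) = Unique.cartesianProductWith⁺ _∷_ Vec.∷-injective (Unique.allFin⁺ m) (allWords-unique m k)

-- The image of the filtered list and `ys` are duplicate-free with the same entries, so each length
-- bounds the other.
length-filter-≡ : ∀ {A B : Set} {P : Pred A 0ℓ} (P? : Decidable P) (f : A → B) {xs : List A} {ys : List B} →
                  (∀ {x y} → f x ≡ f y → x ≡ y) → Unique xs → Unique ys →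
                  (∀ {x} → P x → f x ∈ ys) → (∀ {y} → y ∈ ys → ∃ λ x → x ∈ xs × P x × f x ≡ y) →
                  length (filter P? xs) ≡ length ys
length-filter-≡ P? f {xs} {ys} f-injective xs! ys! to from = trans (sym (List.length-map f (filter P? xs)))
  (ℕ.≤-antisym
    (Unique-⊆-length (Unique.map⁺ f-injective (Unique.filter⁺ P? xs!)) to′)
    (Unique-⊆-length ys! from′))
  where
  to′ : ∀ {y} → y ∈ map f (filter P? xs) → y ∈ ys
  to′ y∈ with x , x∈ , refl ← ∈-map⁻ f y∈ = to (proj₂ (∈-filter⁻ P? {xs = xs} x∈))
  from′ : ∀ {y} → y ∈ ys → y ∈ map f (filter P? xs)
  from′ y∈ with x , x∈ , px , refl ← from y∈ = ∈-map⁺ f (∈-filter⁺ P? x∈ px)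

∣𝔄∣≡pathCount : ∀ {m} n → m ≡ suc (double n) → ∣𝔄∣ m ≡ pathCount m 0
∣𝔄∣≡pathCount {m} n odd = trans
  (length-filter-≡ {P = 𝔄 m} (𝔄? m) letters letters-injective (allWords-unique m m) (words-unique m [] ([] , []))
    (λ a → words-complete m [] ([] , []) (𝔄⇒Good n odd a))
    (λ w∈ → let π , eq , a = Good⇒𝔄 (words-sound m [] ([] , []) w∈) in π , ∈-allWords π , a , eq))
  (length-words m [])

1+2n≡1+double : ∀ n → 1 ℕ.+ 2 ℕ.* n ≡ suc (double n)
1+2n≡1+double n = cong suc (sym (double≡2* n))

u≡pathCount : ∀ n → u n ≡ pathCount (1 ℕ.+ 2 ℕ.* n) 0
u≡pathCount n = ∣𝔄∣≡pathCount {1 ℕ.+ 2 ℕ.* n} n (1+2n≡1+double n)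

U≈δD : U ≈ δ * D
U≈δD n = trans
  (cong fromℕℚ (trans (u≡pathCount n) (cong (λ m → pathCount m 0) (1+2n≡1+double n))))
  (pathCount-series n 0)

theorem6p6 : (U ≈ √1-4x / (√1-4x - nat 2 * X)) × (convergent numerators ⟶ U)
-- Both halves pass through `δ * D`, to which the quotient unfolds by definition.
theorem6p6 = U≈δD , λ n →
  let N , agree = convergents⟶δD n in N , λ k N≤k → trans (agree k N≤k) (sym (U≈δD n))
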